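{- There is no SLOCAL algorithm that finds a proper $3$-coloring in $2$-dimensional grids with locality $o(n^{1/10})$, where $n$ is the number of nodes.
   Context: A $2$-dimensional grid with $n=a\times b$ nodes is the Cartesian product of a path with $a$ nodes and a path with $b$ nodes. $B(v,T)$ denotes the set of nodes within distance $T$ of $v$; $n$ is known to the algorithm. SLOCAL model with locality $T=T(n)$: the adversary assigns the nodes unique identifiers from $\{1,2,\dots,\mathrm{poly}(n)\}$ and chooses an ordering $v_1,\dots,v_n$ of the nodes. Each node has an unbounded local memory, initially empty. Nodes are processed one at a time in this order; when node $v$ is processed, it can read the graph structure, inputs, identifiers and local memories of all nodes in $B(v,T)$, and based on this it must choose its own final output and what to store in its own local memory. An algorithm solves the problem with locality $T$ if for every input graph and every adversarial choice (identifiers and order) the output is a proper $3$-coloring (adjacent nodes get different colors from a set of $3$ colors). -}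

module Defs where

open import Data.Nat using (ℕ; zero; suc; _+_; _*_; _^_; _≤_; ∣_-_∣)
open import Data.Fin using (Fin; toℕ)
import Data.Fin.Properties as FinP
open import Data.Product using (_×_; _,_; proj₁; proj₂; Σ; ∃; ∃-syntax)
open import Data.Product.Properties using (≡-dec)
open import Data.Maybe using (Maybe; just; nothing)
import Data.Maybe as Maybe
open import Data.List using (List; []; _∷_)
open import Data.List.Membership.Propositional using (_∈_)
open import Data.List.Relation.Unary.Unique.Propositional using (Unique)
open import Relation.Binary.PropositionalEquality using (_≡_; _≢_)
open import Relation.Nullary using (¬_; yes; no)
open import Function.Definitions using (Injective)

Node : ℕ → ℕ → Set
Node a b = Fin a × Fin b

_≟N_ : ∀ {a b} (u v : Node a b) → Relation.Nullary.Dec (u ≡ v)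
_≟N_ = ≡-dec FinP._≟_ FinP._≟_

-- Graph distance in the grid (= Manhattan distance of the coordinates).
dist : ∀ {a b} → Node a b → Node a b → ℕ
dist (x , y) (x' , y') = ∣ toℕ x - toℕ x' ∣ + ∣ toℕ y - toℕ y' ∣

Adj : ∀ {a b} → Node a b → Node a b → Set
Adj u v = dist u v ≡ 1

InBall : ∀ {a b} → ℕ → Node a b → Node a b → Set
InBall T v u = dist v u ≤ T

Color : Set
Color = Fin 3

-- An SLOCAL algorithm with local-memory type M.  When a node v of an a×b grid
-- is processed, it gets the identifier assignment and the current memories
-- (nothing = empty, i.e. not yet processed) and returns (output colour, memory).
-- That it only depends on n and on the radius-T view is imposed by `Local`.
Algorithm : Set → Set
Algorithm M = ∀ {a b} → (Node a b → ℕ) → (Node a b → Maybe M) → Node a b → Color × M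

ViewIso : ∀ {M : Set} {a b a' b'} → ℕ →
          (Node a b → ℕ) → (Node a b → Maybe M) → Node a b →
          (Node a' b' → ℕ) → (Node a' b' → Maybe M) → Node a' b' → Set
ViewIso {a = a} {b} {a'} {b'} T id mem v id' mem' v' =
  Σ (Node a b → Node a' b') λ f → Σ (Node a' b' → Node a b) λ g →
    (f v ≡ v') ×
    (∀ u → InBall T v u → InBall T v' (f u) × g (f u) ≡ u) ×
    (∀ w → InBall T v' w → InBall T v (g w) × f (g w) ≡ w) ×
    (∀ u u' → InBall T v u → InBall T v u' →
       (Adj u u' → Adj (f u) (f u')) × (Adj (f u) (f u') → Adj u u')) ×
    (∀ u → InBall T v u → (id' (f u) ≡ id u) × (mem' (f u) ≡ mem u))

Local : ∀ {M : Set} → (ℕ → ℕ) → Algorithm M → Set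
Local {M} T A = ∀ {a b a' b'} → a * b ≡ a' * b' →
  (id : Node a b → ℕ) (mem : Node a b → Maybe M) (v : Node a b)
  (id' : Node a' b' → ℕ) (mem' : Node a' b' → Maybe M) (v' : Node a' b') →
  ViewIso (T (a * b)) id mem v id' mem' v' →
  A id mem v ≡ A id' mem' v'

State : Set → ℕ → ℕ → Set
State M a b = Node a b → Maybe (Color × M)

step : ∀ {M a b} → Algorithm M → (Node a b → ℕ) → State M a b → Node a b → State M a b
step A id s v u with u ≟N v
... | yes _ = just (A id (λ w → Maybe.map proj₂ (s w)) v)
... | no _ = s u

run : ∀ {M a b} → Algorithm M → (Node a b → ℕ) → State M a b → List (Node a b) → State M a b
run A id s [] = s
run A id s (v ∷ vs) = run A id (step A id s v) vs

final : ∀ {M a b} → Algorithm M → (Node a b → ℕ) → List (Node a b) → State M a b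
final A id order = run A id (λ _ → nothing) order

ValidIds : ∀ {a b} → ℕ → (Node a b → ℕ) → Set
ValidIds {a} {b} c id = Injective _≡_ _≡_ id × (∀ v → (1 ≤ id v) × (id v ≤ (a * b) ^ c))

ValidOrder : ∀ {a b} → List (Node a b) → Set
ValidOrder order = Unique order × (∀ v → v ∈ order)

ProperColoring : ∀ {M a b} → State M a b → Set
ProperColoring {a = a} {b} s = ∀ (u w : Node a b) → Adj u w →
  Σ (Color × _) λ p → Σ (Color × _) λ q →
    (s u ≡ just p) × (s w ≡ just q) × (proj₁ p ≢ proj₁ q)

Solves : ∀ {M} → ℕ → Algorithm M → Set
Solves c A = ∀ (a b : ℕ) (id : Node a b → ℕ) (order : List (Node a b)) →
  ValidIds c id → ValidOrder order → ProperColoring (final A id order)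

-- T(n) = o(n^{1/10}), i.e. T(n)^10 / n → 0.
LittleO-n^1/10 : (ℕ → ℕ) → Set
LittleO-n^1/10 T = ∀ (k : ℕ) → ∃[ N ] ∀ n → N ≤ n → k * T n ^ 10 ≤ n

{-# OPTIONS --safe #-}
module Submission where

-- Read colours modulo 3: every edge of a properly coloured grid carries ±1, and
-- the sum around any unit square vanishes.  Hence the sums along two parallel
-- segments at distance d differ by at most 2d, while the sum along a segment of
-- odd length is odd.
--
-- Cut a row into blocks of odd width W = 4T+1 and let the adversary process the
-- middle part of every block before the remainders.  By locality the sum w(i,j)
-- between the centres of adjacent blocks i and j depends only on the identifiers
-- in these two blocks, and it is odd.  By Erdős–Szekeres, among k²+1 blocks some
-- k+1 can be lined up so that all w have the same sign, which gives a row whose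
-- sum is at least k in absolute value.  An algorithm cannot tell a row from its
-- mirror image, so two rows at distance 2T+1 can be given sums ≥ k and ≤ -k;
-- this is impossible for k = 2T+2.

open import Defs
open import Data.Nat using (ℕ; zero; suc; _+_; _*_; _∸_; _^_; _≤_; _<_; z≤n; s≤s; ∣_-_∣; _≤?_; _<?_; >-nonZero)
open import Data.Nat.Properties
open import Data.Nat.DivMod
open import Data.Nat.Divisibility using (n∣m*n)
import Data.Nat.Tactic.RingSolver as ℕSolver
open import Data.Integer as ℤ using (ℤ; +_; 0ℤ; 1ℤ; -1ℤ)
import Data.Integer.Properties as ℤP
import Data.Integer.Tactic.RingSolver as ℤSolver
open import Data.Fin using (Fin; zero; suc; toℕ; fromℕ<; combine)
import Data.Fin.Properties as FinP
open import Data.Product using (_×_; _,_; proj₁; proj₂; Σ; ∃-syntax)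
open import Data.Product.Properties using (,-injective)
open import Data.Sum using (_⊎_; inj₁; inj₂)
open import Data.Maybe using (Maybe; just; nothing; maybe′)
import Data.Maybe as Maybe
open import Data.Unit using (⊤; tt)
open import Data.Empty using (⊥; ⊥-elim)
open import Data.List using (List; []; _∷_; _++_; map; filter; upTo; applyUpTo; allFin; cartesianProduct)
open import Data.List.Properties using (++-identityʳ; filter-++; map-++; filter-accept; filter-reject)
open import Data.List.Membership.Propositional using (_∈_; _∉_)
open import Data.List.Membership.Propositional.Properties
open import Data.List.Relation.Unary.Any using (here; there)
open import Data.List.Relation.Unary.All using (All; []; _∷_)
import Data.List.Relation.Unary.All as All
import Data.List.Relation.Unary.All.Properties as AllP
open import Data.List.Relation.Unary.AllPairs using ([]; _∷_)
open import Data.List.Relation.Unary.Unique.Propositional using (Unique)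
import Data.List.Relation.Unary.Unique.Propositional.Properties as UniqueP
open import Data.List.Relation.Binary.Disjoint.Propositional using (Disjoint)
open import Function using (_∘_)
open import Function.Definitions using (Injective)
open import Relation.Nullary using (¬_; Dec; yes; no)
open import Relation.Nullary.Decidable using (_×-dec_; _→-dec_; ¬?; toWitness)
open import Relation.Unary using (Decidable)
import Relation.Binary as B
open import Relation.Binary using (tri<; tri≈; tri>)
open import Relation.Binary.PropositionalEquality

-- Monotone chains

-- Only consecutive vertices are related, since the sign of a winding is not transitive. The `l`
-- steps give `l + 1` vertices, one per block of a row.
Chain : (ℕ → ℕ → Set) → ℕ → ℕ → Set
Chain R zero    v = ⊤
Chain R (suc l) v = ∃[ i ] (i < v × R v i × Chain R l i)

chain? : ∀ {R} → B.Decidable R → ∀ l v → Dec (Chain R l v)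
chain? R? zero    v = yes tt
chain? R? (suc l) v = anyUpTo? (λ i → R? v i ×-dec chain? R? l i) v

-- The search descends from the failure at `k`, so `l` is the last success below it; for chains this
-- is the greatest length.
last-true : ∀ {P : ℕ → Set} → (∀ l → Dec (P l)) → P 0 → ∀ k → ¬ P k →
            ∃[ l ] (l < k × P l × ¬ P (suc l))
last-true P? p0 zero    ¬pk = ⊥-elim (¬pk p0)
last-true P? p0 (suc k) ¬pk with P? k
... | yes pk = k , ≤-refl , pk , ¬pk
... | no ¬p with last-true P? p0 k ¬p
...   | l , l<k , pl , ¬psl = l , m<n⇒m<1+n l<k , pl , ¬psl

-- Label v by the lengths of the longest R-chain and ¬R-chain from v; two
-- vertices with equal labels cannot be related either way.
erdős-szekeres : ∀ {R} → B.Decidable R → ∀ k →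
  ∃[ v ] (v < suc (k * k) × (Chain R k v ⊎ Chain (λ i j → ¬ R i j) k v))
erdős-szekeres {R} R? k
  with anyUpTo? (chain? R? k) (suc (k * k)) | anyUpTo? (chain? (λ i j → ¬? (R? i j)) k) (suc (k * k))
... | yes (v , v< , ch) | _ = v , v< , inj₁ ch
... | no _ | yes (v , v< , ch) = v , v< , inj₂ ch
... | no none₁ | no none₂ = ⊥-elim (clash (FinP.pigeonhole ≤-refl label))
  where
  longest₁ : (v : Fin (suc (k * k))) → _
  longest₁ v = last-true (λ l → chain? R? l (toℕ v)) tt k (λ ch → none₁ (toℕ v , FinP.toℕ<n v , ch))
  longest₂ : (v : Fin (suc (k * k))) → _
  longest₂ v = last-true (λ l → chain? (λ i j → ¬? (R? i j)) l (toℕ v)) tt k (λ ch → none₂ (toℕ v , FinP.toℕ<n v , ch))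
  label : Fin (suc (k * k)) → Fin (k * k)
  label v = combine (fromℕ< (proj₁ (proj₂ (longest₁ v)))) (fromℕ< (proj₁ (proj₂ (longest₂ v))))
  extend : ∀ {Q : ℕ → ℕ → Set} {i j l l'} → i < j → Q j i → Chain Q l i → ¬ Chain Q (suc l') j → l ≢ l'
  extend i<j q ch ¬ch refl = ¬ch (_ , i<j , q , ch)
  clash : ¬ (∃[ i ] ∃[ j ] (i Data.Fin.< j × label i ≡ label j))
  clash (i , j , i<j , eq) with R? (toℕ j) (toℕ i) | FinP.combine-injective {k} {k} _ _ _ _ eq
  ... | yes r | e , _ = extend i<j r (proj₁ (proj₂ (proj₂ (longest₁ i)))) (proj₂ (proj₂ (proj₂ (longest₁ j)))) (FinP.fromℕ<-injective _ _ _ _ e)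
  ... | no ¬r | _ , e = extend {λ i j → ¬ R i j} i<j ¬r (proj₁ (proj₂ (proj₂ (longest₂ i)))) (proj₂ (proj₂ (proj₂ (longest₂ j)))) (FinP.fromℕ<-injective _ _ _ _ e)

-- Past the end the last vertex is repeated, so that the bound `vertex≤` holds at every position and
-- not only along the chain.
vertex : ∀ {R} l {v} → Chain R l v → ℕ → ℕ
vertex l       {v} ch               zero    = v
vertex zero    {v} ch               (suc q) = v
vertex (suc l)     (i , _ , _ , ch) (suc q) = vertex l ch q

vertex-related : ∀ {R} l {v} (ch : Chain R l v) q → q < l → R (vertex l ch q) (vertex l ch (suc q))
vertex-related (suc zero) (i , _ , r , ch) zero q<l = r
vertex-related (suc (suc l)) (i , _ , r , ch) zero q<l = r
vertex-related (suc l) (i , _ , r , ch) (suc q) (s≤s q<l) = vertex-related l ch q q<l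

vertex-decreasing : ∀ {R} l {v} (ch : Chain R l v) {q q'} → q < q' → q' ≤ l → vertex l ch q' < vertex l ch q
vertex-decreasing (suc l) (i , i<v , r , ch) {zero} {suc zero} q<q' q'≤l with l
... | zero = i<v
... | suc _ = i<v
vertex-decreasing (suc l) (i , i<v , r , ch) {zero} {suc (suc q')} q<q' (s≤s q'≤l) =
  <-trans (vertex-decreasing l ch {zero} {suc q'} (s≤s z≤n) q'≤l) (subst (_< _) (sym (v0 l ch)) i<v)
  where
  v0 : ∀ {R} l {v} (ch : Chain R l v) → vertex l ch 0 ≡ v
  v0 zero ch = refl
  v0 (suc l) ch = refl
vertex-decreasing (suc l) (i , i<v , r , ch) {suc q} {suc q'} (s≤s q<q') (s≤s q'≤l) = vertex-decreasing l ch q<q' q'≤l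

vertex-injective : ∀ {R} l {v} (ch : Chain R l v) {q q'} → q ≤ l → q' ≤ l → vertex l ch q ≡ vertex l ch q' → q ≡ q'
vertex-injective l ch {q} {q'} q≤l q'≤l eq with <-cmp q q'
... | tri< q<q' _ _ = ⊥-elim (<-irrefl (sym eq) (vertex-decreasing l ch q<q' q'≤l))
... | tri≈ _ e _ = e
... | tri> _ _ q'<q = ⊥-elim (<-irrefl eq (vertex-decreasing l ch q'<q q≤l))

vertex≤ : ∀ {R} l {v} (ch : Chain R l v) q → vertex l ch q ≤ v
vertex≤ zero ch zero = ≤-refl
vertex≤ (suc l) ch zero = ≤-refl
vertex≤ zero ch (suc q) = ≤-refl
vertex≤ (suc l) (i , i<v , _ , ch) (suc q) = ≤-trans (vertex≤ l ch q) (<⇒≤ i<v)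

-- Extending partial injections

module Extension {X : Set} (_≟_ : B.Decidable (_≡_ {A = X})) where

  swap : X → X → X → X
  swap p q x with x ≟ p | x ≟ q
  ... | yes _ | _     = q
  ... | no _  | yes _ = p
  ... | no _  | no _  = x

  swap-involutive : ∀ p q x → swap p q (swap p q x) ≡ x
  swap-involutive p q x with x ≟ p | x ≟ q
  swap-involutive p q x | yes x≡p | _ with q ≟ p | q ≟ q
  ... | yes q≡p | _ = trans q≡p (sym x≡p)
  ... | no _ | yes _ = sym x≡p
  ... | no _ | no ¬q = ⊥-elim (¬q refl)
  swap-involutive p q x | no _ | yes x≡q with p ≟ p
  ... | yes _ = sym x≡q
  ... | no ¬p = ⊥-elim (¬p refl)
  swap-involutive p q x | no x≢p | no x≢q with x ≟ p | x ≟ q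
  ... | yes e | _ = ⊥-elim (x≢p e)
  ... | no _ | yes e = ⊥-elim (x≢q e)
  ... | no _ | no _ = refl

  swap-left : ∀ p q → swap p q p ≡ q
  swap-left p q with p ≟ p | p ≟ q
  ... | yes _ | _ = refl
  ... | no ¬e | _ = ⊥-elim (¬e refl)

  swap-other : ∀ {p q x} → x ≢ p → x ≢ q → swap p q x ≡ x
  swap-other {p} {q} {x} x≢p x≢q with x ≟ p | x ≟ q
  ... | yes e | _ = ⊥-elim (x≢p e)
  ... | no _ | yes e = ⊥-elim (x≢q e)
  ... | no _ | no _ = refl

  swap-injective : ∀ p q {x y} → swap p q x ≡ swap p q y → x ≡ y
  swap-injective p q {x} {y} e =
    trans (sym (swap-involutive p q x)) (trans (cong (swap p q) e) (swap-involutive p q y))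

  module _ {P : X → Set} (P? : Decidable P) (ψ : X → X)
           (ψ-inj : ∀ {x y} → P x → P y → ψ x ≡ ψ y → x ≡ y) where

    -- One listed point at a time is corrected by following `π` with the transposition of `π v` and
    -- `ψ v`. The values at the other listed points of `P` stay put: they differ from `π v` as `π`
    -- is injective, and from `ψ v` as `ψ` is injective on `P`.
    extend : ∀ xs → Σ (X → X) λ π → (Injective _≡_ _≡_ π × (∀ {x} → x ∈ xs → P x → π x ≡ ψ x))
    extend [] = (λ x → x) , (λ e → e) , λ ()
    extend (v ∷ xs) with extend xs | P? v
    ... | π , inj , on | no ¬pv = π , inj , λ where
      (here refl) px → ⊥-elim (¬pv px)
      (there x∈) px → on x∈ px
    ... | π , inj , on | yes pv = π' , (λ e → inj (swap-injective _ _ e)) , on'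
      where
      π' : X → X
      π' x = swap (π v) (ψ v) (π x)
      on' : ∀ {x} → x ∈ v ∷ xs → P x → π' x ≡ ψ x
      on' (here refl) px = swap-left _ _
      on' {x} (there x∈) px with x ≟ v
      ... | yes refl = swap-left _ _
      ... | no x≢v = trans (swap-other (λ e → x≢v (inj e))
                       (λ e → x≢v (ψ-inj px pv (trans (sym (on x∈ px)) e)))) (on x∈ px)

-- Winding numbers

-- Colours are read modulo 3, so adjacent nodes of a proper colouring differ by ±1.
δ : Color → Color → ℤ
δ zero             zero             = 0ℤ
δ zero             (suc zero)       = 1ℤ
δ zero             (suc (suc zero)) = -1ℤ
δ (suc zero)       zero             = -1ℤ
δ (suc zero)       (suc zero)       = 0ℤ
δ (suc zero)       (suc (suc zero)) = 1ℤ
δ (suc (suc zero)) zero             = 1ℤ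
δ (suc (suc zero)) (suc zero)       = -1ℤ
δ (suc (suc zero)) (suc (suc zero)) = 0ℤ

δ-antisym : ∀ p q → δ p q ≡ ℤ.- δ q p
δ-antisym = toWitness {a? = FinP.all? λ p → FinP.all? λ q → δ p q ℤP.≟ ℤ.- δ q p} _

-- Both sums are even, lie between -2 and 2, and are congruent modulo 3 to the difference of `s` and
-- `p`. So they differ by an even multiple of 3 of size at most 4, that is by 0. A finite check
-- stands in for this argument.
δ-square : ∀ p q r s → p ≢ q → q ≢ s → p ≢ r → r ≢ s → δ p q ℤ.+ δ q s ≡ δ p r ℤ.+ δ r s
δ-square = toWitness {a? = FinP.all? λ p → FinP.all? λ q → FinP.all? λ r → FinP.all? λ s →
  ¬? (p FinP.≟ q) →-dec (¬? (q FinP.≟ s) →-dec (¬? (p FinP.≟ r) →-dec (¬? (r FinP.≟ s) →-dec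
  (δ p q ℤ.+ δ q s ℤP.≟ δ p r ℤ.+ δ r s))))} _

δ≤1 : ∀ p q → δ p q ℤ.≤ 1ℤ
δ≤1 = toWitness {a? = FinP.all? λ p → FinP.all? λ q → δ p q ℤP.≤? 1ℤ} _

δ-values : ∀ p q → p ≢ q → (δ p q ≡ 1ℤ) ⊎ (δ p q ≡ -1ℤ)
δ-values zero             zero             p≢q = ⊥-elim (p≢q refl)
δ-values zero             (suc zero)       p≢q = inj₁ refl
δ-values zero             (suc (suc zero)) p≢q = inj₂ refl
δ-values (suc zero)       zero             p≢q = inj₂ refl
δ-values (suc zero)       (suc zero)       p≢q = ⊥-elim (p≢q refl)
δ-values (suc zero)       (suc (suc zero)) p≢q = inj₁ refl
δ-values (suc (suc zero)) zero             p≢q = inj₁ refl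
δ-values (suc (suc zero)) (suc zero)       p≢q = inj₂ refl
δ-values (suc (suc zero)) (suc (suc zero)) p≢q = ⊥-elim (p≢q refl)

-- The displacement of the walk after lifting the 3-cycle of colours to the integers; for a closed
-- walk it is three times the winding number.
wind : (ℕ → Color) → ℕ → ℤ
wind C zero    = 0ℤ
wind C (suc n) = wind C n ℤ.+ δ (C n) (C (suc n))

wind-cong : ∀ {C D} n → (∀ t → t ≤ n → C t ≡ D t) → wind C n ≡ wind D n
wind-cong zero    eq = refl
wind-cong (suc n) eq = cong₂ ℤ._+_ (wind-cong n (λ t t≤n → eq t (m≤n⇒m≤1+n t≤n)))
  (cong₂ δ (eq n (n≤1+n n)) (eq (suc n) ≤-refl))

wind-+ : ∀ C m n → wind C (m + n) ≡ wind C m ℤ.+ wind (λ t → C (m + t)) n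
wind-+ C m zero rewrite +-identityʳ m = sym (ℤP.+-identityʳ _)
wind-+ C m (suc n) rewrite +-suc m n | wind-+ C m n = ℤP.+-assoc (wind C m) _ _

-- Every step is traversed backwards and changes sign by `δ-antisym`. This is how mirroring a row
-- turns a large positive winding into a large negative one.
wind-reverse : ∀ C n → wind (λ t → C (n ∸ t)) n ≡ ℤ.- wind C n
wind-reverse C zero = refl
wind-reverse C (suc n) = begin
  wind (λ t → C (suc n ∸ t)) (suc n)
    ≡⟨ wind-+ (λ t → C (suc n ∸ t)) 1 n ⟩
  (0ℤ ℤ.+ δ (C (suc n)) (C n)) ℤ.+ wind (λ t → C (n ∸ t)) n
    ≡⟨ cong₂ ℤ._+_ (cong (λ x → 0ℤ ℤ.+ x) (δ-antisym (C (suc n)) (C n))) (wind-reverse C n) ⟩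
  (0ℤ ℤ.+ ℤ.- δ (C n) (C (suc n))) ℤ.+ ℤ.- wind C n
    ≡⟨ lem (δ (C n) (C (suc n))) (wind C n) ⟩
  ℤ.- (wind C n ℤ.+ δ (C n) (C (suc n))) ∎
  where
  open ≡-Reasoning
  lem : ∀ x y → (0ℤ ℤ.+ ℤ.- x) ℤ.+ ℤ.- y ≡ ℤ.- (y ℤ.+ x)
  lem = ℤSolver.solve-∀

-- With `n` added, an ascending step counts 2 and a descending one 0, so `z` is the number of
-- ascending steps.
wind-parity : ∀ C n → (∀ t → t < n → C t ≢ C (suc t)) → ∃[ z ] (wind C n ℤ.+ + n ≡ + (2 * z))
wind-parity C zero    proper = 0 , refl
wind-parity C (suc n) proper
  with wind-parity C n (λ t t<n → proper t (m<n⇒m<1+n t<n)) | δ-values (C n) (C (suc n)) (proper n ≤-refl)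
... | z , eq | inj₁ d rewrite d = suc z , trans (lem (wind C n) (+ n)) (trans (cong (ℤ._+ (+ 2)) eq)
      (cong +_ (trans (+-comm (2 * z) 2) (sym (*-suc 2 z)))))
  where
  lem : ∀ x y → (x ℤ.+ 1ℤ) ℤ.+ (1ℤ ℤ.+ y) ≡ (x ℤ.+ y) ℤ.+ + 2
  lem = ℤSolver.solve-∀
... | z , eq | inj₂ d rewrite d = z , trans (lem (wind C n) (+ n)) eq
  where
  lem : ∀ x y → (x ℤ.+ -1ℤ) ℤ.+ (1ℤ ℤ.+ y) ≡ x ℤ.+ y
  lem = ℤSolver.solve-∀

wind-odd : ∀ C n h → n ≡ suc (2 * h) → (∀ t → t < n → C t ≢ C (suc t)) → wind C n ≢ 0ℤ
wind-odd C n h odd proper eq with wind-parity C n proper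
... | z , e rewrite eq = even≢odd z h (trans (sym (ℤP.+-injective e)) odd)

-- Summing `δ-square` over the ladder of unit squares between the rows cancels all inner rungs; only
-- the rungs at both ends survive.
wind-adjacent-rows : ∀ C D n →
  (∀ t → t < n → C t ≢ C (suc t)) → (∀ t → t < n → D t ≢ D (suc t)) → (∀ t → t ≤ n → C t ≢ D t) →
  wind C n ℤ.+ δ (C n) (D n) ≡ δ (C 0) (D 0) ℤ.+ wind D n
wind-adjacent-rows C D zero    pC pD pCD = ℤP.+-comm 0ℤ (δ (C 0) (D 0))
wind-adjacent-rows C D (suc n) pC pD pCD = begin
  wind C n ℤ.+ δ (C n) (C (suc n)) ℤ.+ δ (C (suc n)) (D (suc n))
    ≡⟨ ℤP.+-assoc (wind C n) _ _ ⟩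
  wind C n ℤ.+ (δ (C n) (C (suc n)) ℤ.+ δ (C (suc n)) (D (suc n)))
    ≡⟨ cong (λ x → wind C n ℤ.+ x) (δ-square (C n) (C (suc n)) (D n) (D (suc n))
         (pC n ≤-refl) (pCD (suc n) ≤-refl) (pCD n (n≤1+n n)) (pD n ≤-refl)) ⟩
  wind C n ℤ.+ (δ (C n) (D n) ℤ.+ δ (D n) (D (suc n)))
    ≡⟨ sym (ℤP.+-assoc (wind C n) _ _) ⟩
  wind C n ℤ.+ δ (C n) (D n) ℤ.+ δ (D n) (D (suc n))
    ≡⟨ cong (ℤ._+ δ (D n) (D (suc n))) (wind-adjacent-rows C D n
         (λ t t<n → pC t (m<n⇒m<1+n t<n)) (λ t t<n → pD t (m<n⇒m<1+n t<n))
         (λ t t≤n → pCD t (m≤n⇒m≤1+n t≤n))) ⟩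
  δ (C 0) (D 0) ℤ.+ wind D n ℤ.+ δ (D n) (D (suc n))
    ≡⟨ ℤP.+-assoc (δ (C 0) (D 0)) _ _ ⟩
  δ (C 0) (D 0) ℤ.+ (wind D n ℤ.+ δ (D n) (D (suc n))) ∎
  where open ≡-Reasoning

-- Passing to the next row costs the two end rungs, each at most 1 by `δ≤1`, hence 2 per row.
wind-rows : ∀ (G : ℕ → ℕ → Color) n d →
  (∀ t y → t < n → y ≤ d → G y t ≢ G y (suc t)) → (∀ t y → t ≤ n → y < d → G y t ≢ G (suc y) t) →
  wind (G 0) n ℤ.≤ wind (G d) n ℤ.+ + (2 * d)
wind-rows G n zero    hor ver = ℤP.≤-reflexive (sym (ℤP.+-identityʳ _))
wind-rows G n (suc d) hor ver = begin
  wind (G 0) n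
    ≤⟨ wind-rows G n d (λ t y t< y≤ → hor t y t< (m≤n⇒m≤1+n y≤)) (λ t y t≤ y< → ver t y t≤ (m<n⇒m<1+n y<)) ⟩
  wind (G d) n ℤ.+ + (2 * d)
    ≡⟨ lem₁ (wind (G d) n) (δ (G d n) (G (suc d) n)) (+ (2 * d)) ⟩
  (wind (G d) n ℤ.+ δ (G d n) (G (suc d) n)) ℤ.+ ℤ.- δ (G d n) (G (suc d) n) ℤ.+ + (2 * d)
    ≡⟨ cong₂ (λ x y → x ℤ.+ y ℤ.+ + (2 * d)) (wind-adjacent-rows (G d) (G (suc d)) n
         (λ t t< → hor t d t< (n≤1+n d)) (λ t t< → hor t (suc d) t< ≤-refl) (λ t t≤ → ver t d t≤ ≤-refl))
         (sym (δ-antisym _ _)) ⟩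
  (δ (G d 0) (G (suc d) 0) ℤ.+ wind (G (suc d)) n) ℤ.+ δ (G (suc d) n) (G d n) ℤ.+ + (2 * d)
    ≤⟨ ℤP.+-monoˡ-≤ (+ (2 * d)) (ℤP.+-mono-≤ (ℤP.+-monoˡ-≤ (wind (G (suc d)) n) (δ≤1 (G d 0) (G (suc d) 0))) (δ≤1 (G (suc d) n) (G d n))) ⟩
  (1ℤ ℤ.+ wind (G (suc d)) n) ℤ.+ 1ℤ ℤ.+ + (2 * d)
    ≡⟨ lem₂ (wind (G (suc d)) n) (+ (2 * d)) ⟩
  wind (G (suc d)) n ℤ.+ (+ 2 ℤ.+ + (2 * d))
    ≡⟨ cong (λ x → wind (G (suc d)) n ℤ.+ + x) (sym (*-suc 2 d)) ⟩
  wind (G (suc d)) n ℤ.+ + (2 * suc d) ∎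
  where
  open ℤP.≤-Reasoning
  lem₁ : ∀ x y z → x ℤ.+ z ≡ (x ℤ.+ y) ℤ.+ ℤ.- y ℤ.+ z
  lem₁ = ℤSolver.solve-∀
  lem₂ : ∀ x z → (1ℤ ℤ.+ x) ℤ.+ 1ℤ ℤ.+ z ≡ x ℤ.+ (+ 2 ℤ.+ z)
  lem₂ = ℤSolver.solve-∀

wind-blocks : ∀ ε C W k → (∀ q → q < k → 1ℤ ℤ.≤ ε ℤ.* wind (λ t → C (q * W + t)) W) →
  + k ℤ.≤ ε ℤ.* wind C (k * W)
wind-blocks ε C W zero    pos = ℤP.≤-reflexive (sym (ℤP.*-zeroʳ ε))
wind-blocks ε C W (suc k) pos = begin
  + suc k
    ≤⟨ ℤP.+-mono-≤ (pos 0 (s≤s z≤n))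
         (wind-blocks ε (λ t → C (W + t)) W k λ q q<k →
           subst (λ x → 1ℤ ℤ.≤ ε ℤ.* x) (wind-cong W λ t _ → cong C (+-assoc W (q * W) t)) (pos (suc q) (s≤s q<k))) ⟩
  ε ℤ.* wind C W ℤ.+ ε ℤ.* wind (λ t → C (W + t)) (k * W)
    ≡⟨ ℤP.*-distribˡ-+ ε (wind C W) _ ⟨
  ε ℤ.* (wind C W ℤ.+ wind (λ t → C (W + t)) (k * W))
    ≡⟨ cong (λ x → ε ℤ.* x) (wind-+ C W (k * W)) ⟨
  ε ℤ.* wind C (W + k * W) ∎
  where open ℤP.≤-Reasoning

-- Simulation

dist-refl : ∀ {a b} (u : Node a b) → dist u u ≡ 0
dist-refl (x , y) = cong₂ _+_ (∣n-n∣≡0 (toℕ x)) (∣n-n∣≡0 (toℕ y))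

memory : ∀ {M a b} → State M a b → Node a b → Maybe M
memory s w = Maybe.map proj₂ (s w)

module _ {M : Set} {a b : ℕ} (A : Algorithm M) (id : Node a b → ℕ) where

  step-same : ∀ s v → step A id s v v ≡ just (A id (memory s) v)
  step-same s v with v ≟N v
  ... | yes _ = refl
  ... | no v≢v = ⊥-elim (v≢v refl)

  step-other : ∀ s {u v} → u ≢ v → step A id s v u ≡ s u
  step-other s {u} {v} u≢v with u ≟N v
  ... | yes u≡v = ⊥-elim (u≢v u≡v)
  ... | no _ = refl

  run-++ : ∀ s vs ws → run A id s (vs ++ ws) ≡ run A id (run A id s vs) ws
  run-++ s []       ws = refl
  run-++ s (v ∷ vs) ws = run-++ (step A id s v) vs ws

  run-other : ∀ s {u} vs → u ∉ vs → run A id s vs u ≡ s u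
  run-other s []       u∉ = refl
  run-other s (v ∷ vs) u∉ = trans (run-other _ vs (λ u∈ → u∉ (there u∈))) (step-other s (λ e → u∉ (here e)))

-- The maps are total but constrained on `D` and `D'` only. Distances, not just adjacency, are
-- preserved, so that balls are carried to balls.
record PartialIso {a b} (id id' : Node a b → ℕ) (D D' : Node a b → Set) : Set where
  field
    to from  : Node a b → Node a b
    to-D     : ∀ {u} → D u → D' (to u)
    from-D   : ∀ {u} → D' u → D (from u)
    from-to  : ∀ {u} → D u → from (to u) ≡ u
    to-from  : ∀ {u} → D' u → to (from u) ≡ u
    to-dist  : ∀ {u w} → D u → D w → dist (to u) (to w) ≡ dist u w
    to-id    : ∀ {u} → D u → id' (to u) ≡ id u

-- Two schedules that, up to the isomorphism, process the same nodes of D and D'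
-- in the same order; processed nodes must see nothing beyond D and D'.
module Simulation {a b} {id id' : Node a b → ℕ} {D D' : Node a b → Set}
                  (iso : PartialIso id id' D D') (T : ℕ) where
  open PartialIso iso

  infixr 5 _∷ˢ_
  data Sim : List (Node a b) → List (Node a b) → Set where
    []    : Sim [] []
    skipˡ : ∀ {v vs vs'} → ¬ D v → Sim vs vs' → Sim (v ∷ vs) vs'
    skipʳ : ∀ {v' vs vs'} → ¬ D' v' → Sim vs vs' → Sim vs (v' ∷ vs')
    _∷ˢ_  : ∀ {v v' vs vs'} →
            to v ≡ v' × (∀ u → InBall T v u → D u) × (∀ u → InBall T v' u → D' u) →
            Sim vs vs' → Sim (v ∷ vs) (v' ∷ vs')

  _++ˢ_ : ∀ {vs vs' ws ws'} → Sim vs vs' → Sim ws ws' → Sim (vs ++ ws) (vs' ++ ws')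
  []         ++ˢ t = t
  skipˡ ¬d s ++ˢ t = skipˡ ¬d (s ++ˢ t)
  skipʳ ¬d s ++ˢ t = skipʳ ¬d (s ++ˢ t)
  (m ∷ˢ s)   ++ˢ t = m ∷ˢ (s ++ˢ t)

  skips : ∀ {vs vs'} → All (λ v → ¬ D v) vs → All (λ v → ¬ D' v) vs' → Sim vs vs'
  skips []       []         = []
  skips []       (d' ∷ ds') = skipʳ d' (skips [] ds')
  skips (d ∷ ds) ds'        = skipˡ d (skips ds ds')

  module _ {M : Set} where

    Agree : State M a b → State M a b → Set
    Agree s s' = ∀ {u} → D u → s' (to u) ≡ s u

    module _ {Tf : ℕ → ℕ} (A : Algorithm M) (local : Local Tf A) (T≡ : Tf (a * b) ≡ T) where

      -- The balls around `v` and `v'` lie inside `D` and `D'`, where `to` preserves distances,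
      -- identifiers and memories; hence it restricts to an isomorphism of the radius-`T` views and
      -- locality applies.
      same-view : ∀ {s s' v v'} → Agree s s' → to v ≡ v' →
        (∀ u → InBall T v u → D u) → (∀ u → InBall T v' u → D' u) →
        A id (memory s) v ≡ A id' (memory s') v'
      same-view {s} {s'} {v} {v'} agree refl ballD ballD' =
        local refl id (memory s) v id' (memory s') v'
          (subst (λ t → ViewIso t id (memory s) v id' (memory s') v') (sym T≡)
            ( to , from , refl
            , (λ u u∈ → subst (_≤ T) (sym (to-dist v∈D (ballD u u∈))) u∈ , from-to (ballD u u∈))
            , (λ u u∈ → subst (_≤ T) (trans (cong (dist (to v)) (sym (to-from (ballD' u u∈))))
                                        (to-dist v∈D (from-D (ballD' u u∈)))) u∈
                      , to-from (ballD' u u∈))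
            , (λ u w u∈ w∈ → (λ e → trans (to-dist (ballD u u∈) (ballD w w∈)) e)
                           , (λ e → trans (sym (to-dist (ballD u u∈) (ballD w w∈))) e))
            , (λ u u∈ → to-id (ballD u u∈) , cong (Maybe.map proj₂) (agree (ballD u u∈)))))
        where
        v∈D : D v
        v∈D = ballD v (subst (_≤ T) (sym (dist-refl v)) z≤n)

      run-sim : ∀ {vs vs'} → Sim vs vs' → ∀ {s s'} → Agree s s' → Agree (run A id s vs) (run A id' s' vs')
      run-sim []           agree = agree
      run-sim (skipˡ ¬d p) {s} agree = run-sim p λ {u} d →
        trans (agree d) (sym (step-other A id s λ e → ¬d (subst D e d)))
      run-sim (skipʳ ¬d p) {s} {s'} agree = run-sim p λ {u} d →
        trans (step-other A id' s' λ e → ¬d (subst D' e (to-D d))) (agree d)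
      run-sim (_∷ˢ_ {v} {v'} (eq , ballD , ballD') p) {s} {s'} agree = run-sim p agree'
        where
        v∈D : D v
        v∈D = ballD v (subst (_≤ T) (sym (dist-refl v)) z≤n)
        agree' : Agree (step A id s v) (step A id' s' v')
        agree' {u} d with u ≟N v
        ... | yes refl = trans (cong (step A id' s' v') eq)
              (trans (step-same A id' s' v') (cong just (sym (same-view {s} {s'} agree eq ballD ballD'))))
        -- If `to u` were `v'`, applying `from` would give `u ≡ v`.
        ... | no u≢v = trans (step-other A id' s' λ e →
              u≢v (trans (sym (from-to d)) (trans (cong from (trans e (sym eq))) (from-to v∈D)))) (agree d)

-- Strips of blocks

module Geometry (T m k : ℕ) where

  -- An odd width makes the winding between adjacent block centres odd. Offset `2 * T` is the
  -- centre, offsets `T` to `3 * T` form the core, and margins of `T` nodes keep the view of a core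
  -- inside its block. A row has `suc k` blocks.
  W L : ℕ
  W = suc (4 * T)
  L = suc k * W

  Grid : Set
  Grid = Node (suc m) (suc m)

  -- Junk value 0 outside the grid.
  clamp : ℕ → Fin (suc m)
  clamp x with x <? suc m
  ... | yes x< = fromℕ< x<
  ... | no _   = zero

  toℕ-clamp : ∀ {x} → x < suc m → toℕ (clamp x) ≡ x
  toℕ-clamp {x} x< with x <? suc m
  ... | yes p = FinP.toℕ-fromℕ< p
  ... | no ¬p = ⊥-elim (¬p x<)

  clamp-toℕ : ∀ i → clamp (toℕ i) ≡ i
  clamp-toℕ i = FinP.toℕ-injective (toℕ-clamp (FinP.toℕ<n i))

  ∣-∣≤⇒≤ˡ : ∀ {p q} → ∣ p - q ∣ ≤ T → p ≤ q + T
  ∣-∣≤⇒≤ˡ {p} {q} h = ≤-trans (m≤n+∣m-n∣ p q) (+-monoʳ-≤ q h)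

  ∣-∣≤⇒≤ʳ : ∀ {p q} → ∣ p - q ∣ ≤ T → q ≤ p + T
  ∣-∣≤⇒≤ʳ {p} {q} h = ≤-trans (m≤n+∣n-m∣ q p) (+-monoʳ-≤ p h)

  -- `F` translates coordinates along the row into columns and, being an involution, also back.
  -- `F-near` keeps the columns within `T` of an inner coordinate among the first `L` ones.
  record Orientation : Set where
    field
      F            : ℕ → ℕ
      F-<          : ∀ {z} → z < L → F z < L
      F-involutive : ∀ {z} → z < L → F (F z) ≡ z
      F-isometry   : ∀ {z z'} → z < L → z' < L → ∣ F z - F z' ∣ ≡ ∣ z - z' ∣
      F-near       : ∀ {z x} → T ≤ z → z + T < L → ∣ F z - x ∣ ≤ T → x < L

    F-injective : ∀ {z z'} → z < L → z' < L → F z ≡ F z' → z ≡ z'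
    F-injective z< z'< e = trans (sym (F-involutive z<)) (trans (cong F e) (F-involutive z'<))

    place : ℕ → Fin (suc m) → Grid
    place z y = clamp (F z) , y

  open Orientation

  straight : Orientation
  straight = record
    { F = λ z → z ; F-< = λ z< → z< ; F-involutive = λ _ → refl ; F-isometry = λ _ _ → refl
    ; F-near = λ T≤z z+T< near → ≤-<-trans (∣-∣≤⇒≤ʳ near) z+T< }

  mirrored : Orientation
  mirrored = record
    { F = M ∸_
    ; F-< = λ {z} _ → s≤s (m∸n≤m M z)
    ; F-involutive = λ { (s≤s z≤M) → m∸[m∸n]≡n z≤M }
    ; F-isometry = λ { {z} {z'} (s≤s z≤M) (s≤s z'≤M) → isometry z≤M z'≤M }
    ; F-near = λ {z} {x} T≤z z+T< near → s≤s (begin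
        x              ≤⟨ ∣-∣≤⇒≤ʳ near ⟩
        (M ∸ z) + T    ≤⟨ +-monoʳ-≤ (M ∸ z) T≤z ⟩
        (M ∸ z) + z    ≡⟨ m∸n+n≡m (m+n≤o⇒m≤o z (≤-pred z+T<)) ⟩
        M              ∎) }
    where
    open ≤-Reasoning
    -- `M` is `L - 1`, the last coordinate.
    M : ℕ
    M = 4 * T + k * W
    isometry : ∀ {z z'} → z ≤ M → z' ≤ M → ∣ M ∸ z - M ∸ z' ∣ ≡ ∣ z - z' ∣
    isometry {z} {z'} z≤M z'≤M = begin-equality
      ∣ M ∸ z - M ∸ z' ∣
        -- Adding `z + z'` to both terms of the difference undoes the truncated subtractions.
        ≡⟨ ∣m+n-m+o∣≡∣n-o∣ (z + z') _ _ ⟨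
      ∣ (z + z') + (M ∸ z) - (z + z') + (M ∸ z') ∣
        ≡⟨ cong₂ ∣_-_∣ (trans (cong (_+ (M ∸ z)) (+-comm z z')) (trans (+-assoc z' z _) (cong (λ w → z' + w) (m+[n∸m]≡n z≤M))))
                       (trans (+-assoc z z' _) (cong (λ w → z + w) (m+[n∸m]≡n z'≤M))) ⟩
      ∣ z' + M - z + M ∣
        ≡⟨ cong₂ ∣_-_∣ (+-comm z' M) (+-comm z M) ⟩
      ∣ M + z' - M + z ∣
        ≡⟨ ∣m+n-m+o∣≡∣n-o∣ M z' z ⟩
      ∣ z' - z ∣
        ≡⟨ ∣-∣-comm z' z ⟩
      ∣ z - z' ∣ ∎

  -- Offset `2 * T` is the middle of a block, so the reflection maps the segment from the first to
  -- the last block centre onto itself, reversed.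
  mirrored-centre : ∀ t → t ≤ k * W → F mirrored (2 * T + t) ≡ 2 * T + (k * W ∸ t)
  mirrored-centre t t≤ = begin
    (4 * T + k * W) ∸ (2 * T + t)           ≡⟨ cong (_∸ (2 * T + t)) (lem T (k * W)) ⟩
    (2 * T + (2 * T + k * W)) ∸ (2 * T + t) ≡⟨ [m+n]∸[m+o]≡n∸o (2 * T) _ t ⟩
    (2 * T + k * W) ∸ t                     ≡⟨ +-∸-assoc (2 * T) t≤ ⟩
    2 * T + (k * W ∸ t)                     ∎
    where
    open ≡-Reasoning
    lem : ∀ T x → 4 * T + x ≡ 2 * T + (2 * T + x)
    lem = ℕSolver.solve-∀

  -- The grid serves as a stock of blocks: block `q` of a row copies the identifiers of stock block
  -- `σ q`.
  lay : (ℕ → ℕ) → ℕ → Fin (suc m) → Grid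
  lay σ z y = clamp (σ (z / W) * W + z % W) , y

  offset-/ : ∀ q z → (q * W + z) / W ≡ q + z / W
  offset-/ q z = trans (+-distrib-/-∣ˡ z (n∣m*n q)) (cong (_+ z / W) (m*n/n≡m q W))

  offset-% : ∀ q z → (q * W + z) % W ≡ z % W
  offset-% q z = trans (cong (_% W) (+-comm (q * W) z)) ([m+kn]%n≡m%n z q W)

  -- A window of width `2 * W` meets only the blocks at positions `q` and `suc q`: the quotient
  -- `z / W` is 0 or 1.
  lay-window : ∀ {σ σ' q q'} → σ q ≡ σ' q' → σ (suc q) ≡ σ' (suc q') → ∀ {z} → z < 2 * W → ∀ y →
               lay σ (q * W + z) y ≡ lay σ' (q' * W + z) y
  lay-window {σ} {σ'} {q} {q'} e₀ e₁ {z} z< y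
    rewrite offset-/ q z | offset-/ q' z | offset-% q z | offset-% q' z
    with z / W | m<n*o⇒m/o<n {z} {2} {W} z<
  ... | zero | _ rewrite +-identityʳ q | +-identityʳ q' | e₀ = refl
  ... | suc zero | _ rewrite +-comm q 1 | +-comm q' 1 | e₁ = refl
  ... | suc (suc _) | s≤s (s≤s ())

  applyUpTo-+ : ∀ {X : Set} (f : ℕ → X) p q → applyUpTo f (p + q) ≡ applyUpTo f p ++ applyUpTo (λ t → f (p + t)) q
  applyUpTo-+ f zero    q = refl
  applyUpTo-+ f (suc p) q = cong (f 0 ∷_) (applyUpTo-+ (λ t → f (suc t)) p q)

  -- Core nodes see their own block only.
  Core : ℕ → Set
  Core z = T ≤ z % W × z % W ≤ 3 * T

  core? : Decidable Core
  core? z = (T ≤? z % W) ×-dec (z % W ≤? 3 * T)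

  3T<W : 3 * T < W
  3T<W = s≤s (*-monoˡ-≤ T {3} {4} (n≤1+n 3))

  -- A non-core node sees no further than the two nearest cores, so In₂ suffices for the second phase.
  In₁ In₂ : ℕ → Set
  In₁ z = z < 2 * W
  In₂ z = T ≤ z × z ≤ W + 3 * T

  In₂⇒In₁ : ∀ {z} → In₂ z → In₁ z
  In₂⇒In₁ (_ , z≤) = ≤-<-trans z≤ (+-monoʳ-< W (subst (3 * T <_) (sym (+-identityʳ W)) 3T<W))

  module _ {z : ℕ} (z< : z < 2 * W) where

    core-interior : Core z → T ≤ z × z + T < 2 * W
    core-interior (T≤ , ≤3T) = ≤-trans T≤ (m%n≤m z W) , (begin-strict
      z + T                       ≡⟨ cong (_+ T) (m≡m%n+[m/n]*n z W) ⟩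
      z % W + (z / W) * W + T     ≤⟨ +-monoˡ-≤ T (+-mono-≤ ≤3T (*-monoˡ-≤ W (≤-pred (m<n*o⇒m/o<n {z} {2} {W} z<)))) ⟩
      3 * T + 1 * W + T           ≡⟨ lem T W ⟩
      4 * T + 1 * W               <⟨ ≤-refl ⟩
      2 * W                       ∎)
      where
      open ≤-Reasoning
      lem : ∀ T W → 3 * T + 1 * W + T ≡ 4 * T + 1 * W
      lem = ℕSolver.solve-∀

    -- The bounds on `z` run from the start of the first core to the end of the second, so a node
    -- outside both cores lies in the gap between them.
    ¬core-interior : ¬ Core z → T ≤ z → z ≤ W + 3 * T → 3 * T < z × z < W + T
    ¬core-interior ¬core T≤z z≤ = ≰⇒> left , ≰⇒> right
      where
      left : ¬ (z ≤ 3 * T)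
      left z≤3T = ¬core (subst (λ r → T ≤ r × r ≤ 3 * T) (sym (m<n⇒m%n≡m (≤-<-trans z≤3T 3T<W))) (T≤z , z≤3T))
      right : ¬ (W + T ≤ z)
      right W+T≤z with m≤n⇒∃[o]m+o≡n (m+n≤o⇒m≤o W W+T≤z)
      ... | r , refl = ¬core (subst (λ r → T ≤ r × r ≤ 3 * T) (sym %≡r) (+-cancelˡ-≤ W T r W+T≤z , r≤))
        where
        r≤ : r ≤ 3 * T
        r≤ = +-cancelˡ-≤ W r (3 * T) z≤
        %≡r : (W + r) % W ≡ r
        %≡r = trans (cong (_% W) (+-comm W r)) (trans ([m+n]%n≡m%n r W) (m<n⇒m%n≡m (≤-<-trans r≤ 3T<W)))

  window≤L : ∀ {q} → q < k → q * W + 2 * W ≤ L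
  window≤L {q} q<k = begin
    q * W + 2 * W ≡⟨ *-distribʳ-+ W q 2 ⟨
    (q + 2) * W   ≡⟨ cong (_* W) (+-comm q 2) ⟩
    suc (suc q) * W ≤⟨ *-monoˡ-≤ W (s≤s q<k) ⟩
    L ∎
    where open ≤-Reasoning

  window<L : ∀ {q z} → q < k → z < 2 * W → q * W + z < L
  window<L {q} q<k z< = <-≤-trans (+-monoʳ-< (q * W) z<) (window≤L q<k)

  module _ (L≤ : L ≤ suc m) where

    toℕ-place : ∀ (O : Orientation) {z} → z < L → toℕ (clamp (F O z)) ≡ F O z
    toℕ-place O z< = toℕ-clamp (<-≤-trans (F-< O z<) L≤)

    place-injective : ∀ (O : Orientation) {z z' y y'} → z < L → z' < L → place O z y ≡ place O z' y' → z ≡ z' × y ≡ y'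
    place-injective O z< z'< e with ,-injective e
    ... | e₁ , e₂ = F-injective O z< z'< (trans (sym (toℕ-place O z<)) (trans (cong toℕ e₁) (toℕ-place O z'<))) , e₂

    module _ (c : ℕ) (c≤ : c ≤ m) where

      row : Fin (suc m)
      row = clamp c

      InStrip : Fin (suc m) → Set
      InStrip y = c ≤ toℕ y + T × toℕ y ≤ c + T

      Off : Grid → Set
      Off u = ¬ InStrip (proj₂ u)

      Region : Orientation → ℕ → (ℕ → Set) → Grid → Set
      Region O q In u = ∃[ z ] ∃[ y ] (In z × InStrip y × u ≡ place O (q * W + z) y)

      off-region : ∀ O q In {u} → Off u → ¬ Region O q In u
      off-region O q In off (z , y , _ , strip , refl) = off strip

      -- The coordinate of `u` is `F O` of its column, and by isometry it is within `T` of
      -- `q * W + z₀`. Since `T ≤ z₀`, it does not precede the window, so its offset in the window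
      -- is a genuine difference.
      ball-in-region : ∀ O {q z₀} {In : ℕ → Set} → q < k → T ≤ z₀ → z₀ + T < 2 * W →
        (∀ z → z₀ ≤ z + T → z ≤ z₀ + T → In z) →
        ∀ u → InBall T (place O (q * W + z₀) row) u → Region O q In u
      ball-in-region O {q} {z₀} q<k T≤z₀ z₀+T< near (x , y) h =
        z , y , near z (+-cancelˡ-≤ o z₀ (z + T) low) (+-cancelˡ-≤ o z (z₀ + T) high) ,
        (subst (_≤ toℕ y + T) c≡ (∣-∣≤⇒≤ˡ hy) , subst (λ c → toℕ y ≤ c + T) c≡ (∣-∣≤⇒≤ʳ hy)) ,
        cong (_, y) (sym (trans (cong (λ w → clamp (F O w)) o+z) (trans (cong clamp (F-involutive O x<L)) (clamp-toℕ x))))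
        where
        o : ℕ
        o = q * W
        z₀< : o + z₀ < L
        z₀< = window<L q<k (m+n≤o⇒m≤o (suc z₀) z₀+T<)
        hx : ∣ F O (o + z₀) - toℕ x ∣ ≤ T
        hx = subst (λ w → ∣ w - toℕ x ∣ ≤ T) (toℕ-place O z₀<) (m+n≤o⇒m≤o _ h)
        hy : ∣ toℕ row - toℕ y ∣ ≤ T
        hy = m+n≤o⇒n≤o _ h
        c≡ : toℕ row ≡ c
        c≡ = toℕ-clamp (s≤s c≤)
        x<L : toℕ x < L
        x<L = F-near O (≤-trans T≤z₀ (m≤n+m z₀ o)) (subst (_< L) (sym (+-assoc o z₀ T)) (window<L q<k z₀+T<)) hx
        hx' : ∣ o + z₀ - F O (toℕ x) ∣ ≤ T
        hx' = subst (_≤ T) (trans (cong (λ w → ∣ F O (o + z₀) - w ∣) (sym (F-involutive O x<L)))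
                             (F-isometry O z₀< (F-< O x<L))) hx
        o≤ : o ≤ F O (toℕ x)
        o≤ = +-cancelʳ-≤ T o _ (≤-trans (+-monoʳ-≤ o T≤z₀) (∣-∣≤⇒≤ˡ hx'))
        z : ℕ
        z = F O (toℕ x) ∸ o
        o+z : o + z ≡ F O (toℕ x)
        o+z = m+[n∸m]≡n o≤
        low : o + z₀ ≤ o + (z + T)
        low = subst (o + z₀ ≤_) (trans (cong (_+ T) (sym o+z)) (+-assoc o z T)) (∣-∣≤⇒≤ˡ hx')
        high : o + z ≤ o + (z₀ + T)
        high = subst₂ _≤_ (sym o+z) (+-assoc o z₀ T) (∣-∣≤⇒≤ʳ hx')

      not-in-region : ∀ O {q z' y} {In : ℕ → Set} → q < k → (∀ {z} → In z → z < 2 * W) → z' < L →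
        (∀ {z} → In z → z' ≢ q * W + z) → ¬ Region O q In (place O z' y)
      not-in-region O q<k In< z'< z'∉ (z , y , in-z , _ , e) =
        z'∉ in-z (proj₁ (place-injective O z'< (window<L q<k (In< in-z)) e))

      -- The order follows coordinates, not columns, so a mirrored row is also processed in mirrored
      -- order.
      visits : Orientation → ∀ {P : ℕ → Set} → Decidable P → List ℕ → List Grid
      visits O P? zs = map (λ z → place O z row) (filter P? zs)

      visits-++ : ∀ O {P : ℕ → Set} (P? : Decidable P) zs zs' → visits O P? (zs ++ zs') ≡ visits O P? zs ++ visits O P? zs'
      visits-++ O P? zs zs' = trans (cong (map _) (filter-++ P? zs zs')) (map-++ _ (filter P? zs) _)

      visits-split : ∀ O {P : ℕ → Set} (P? : Decidable P) {q} → q < k → ∃[ r ] (q * W + 2 * W + r ≡ L ×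
        visits O P? (upTo L) ≡ (visits O P? (upTo (q * W)) ++ visits O P? (applyUpTo (λ t → q * W + t) (2 * W)))
                               ++ visits O P? (applyUpTo (λ t → q * W + 2 * W + t) r))
      visits-split O P? {q} q<k with m≤n⇒∃[o]m+o≡n (window≤L q<k)
      ... | r , eq = r , eq ,
        trans (cong (visits O P?) (trans (cong upTo (sym eq)) (applyUpTo-+ (λ z → z) (q * W + 2 * W) r)))
          (trans (visits-++ O P? (upTo (q * W + 2 * W)) (applyUpTo (λ t → q * W + 2 * W + t) r))
            (cong (_++ visits O P? (applyUpTo (λ t → q * W + 2 * W + t) r))
              (trans (cong (visits O P?) (applyUpTo-+ (λ z → z) (q * W) (2 * W)))
                (visits-++ O P? (upTo (q * W)) (applyUpTo (λ t → q * W + t) (2 * W))))))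

      module _ (O : Orientation) {q : ℕ} (q<k : q < k) {In : ℕ → Set} (In< : ∀ {z} → In z → z < 2 * W)
               {P : ℕ → Set} (P? : Decidable P) where

        visits-before : All (λ v → ¬ Region O q In v) (visits O P? (upTo (q * W)))
        visits-before = AllP.map⁺ (AllP.filter⁺ P? (AllP.applyUpTo⁺₁ (λ z → z) (q * W) λ {z} z< →
          not-in-region O q<k In< (<-≤-trans z< (m+n≤o⇒m≤o (q * W) (window≤L q<k)))
            λ _ e → <⇒≱ z< (subst (q * W ≤_) (sym e) (m≤m+n (q * W) _))))

        visits-after : ∀ {r} → q * W + 2 * W + r ≡ L →
          All (λ v → ¬ Region O q In v) (visits O P? (applyUpTo (λ t → q * W + 2 * W + t) r))
        visits-after {r} eq = AllP.map⁺ (AllP.filter⁺ P? (AllP.applyUpTo⁺₁ (λ t → q * W + 2 * W + t) r λ {t} t< →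
          not-in-region O q<k In< (subst (q * W + 2 * W + t <_) eq (+-monoʳ-< (q * W + 2 * W) t<))
            λ iz e → <⇒≱ (+-monoʳ-< (q * W) (In< iz)) (subst (q * W + 2 * W ≤_) e (m≤m+n _ t))))

      -- Comparison of windows in two runs

      module _ (base : Grid → ℕ) where

        -- A two-phase run seen from one strip. Identifiers off the strip, and the visits off the
        -- strip before and after it in each phase, are left free, so that a row studied alone can
        -- be compared with one that shares its grid with another strip.
        record Setup : Set where
          field
            orient : Orientation
            σ      : ℕ → ℕ
            id     : Grid → ℕ
            id-lay : ∀ {z y} → z < L → InStrip y → id (place orient z y) ≡ base (lay σ z y)
            pre₁ post₁ pre₂ post₂ : List Grid
            off-pre₁  : All Off pre₁
            off-post₁ : All Off post₁
            off-pre₂  : All Off pre₂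
            off-post₂ : All Off post₂

          cores rests : List Grid
          cores = pre₁ ++ (visits orient core? (upTo L) ++ post₁)
          rests = pre₂ ++ (visits orient (λ z → ¬? (core? z)) (upTo L) ++ post₂)

        open Setup

        move : Setup → ℕ → Setup → ℕ → Grid → Grid
        move S q S' q' (x , y) = place (orient S') (q' * W + (F (orient S) (toℕ x) ∸ q * W)) y

        move-place : ∀ S q S' q' {z} y → q < k → z < 2 * W →
          move S q S' q' (place (orient S) (q * W + z) y) ≡ place (orient S') (q' * W + z) y
        move-place S q S' q' {z} y q<k z< = cong (λ w → place (orient S') (q' * W + w) y) (begin
          F O (toℕ (clamp (F O (q * W + z)))) ∸ q * W ≡⟨ cong (λ w → F O w ∸ q * W) (toℕ-place O (window<L q<k z<)) ⟩
          F O (F O (q * W + z)) ∸ q * W               ≡⟨ cong (_∸ q * W) (F-involutive O (window<L q<k z<)) ⟩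
          (q * W + z) ∸ q * W                         ≡⟨ m+n∸m≡n (q * W) z ⟩
          z                                           ∎)
          where
          open ≡-Reasoning
          O : Orientation
          O = orient S

        place-dist : ∀ O q {z z'} y y' → q < k → z < 2 * W → z' < 2 * W →
          dist (place O (q * W + z) y) (place O (q * W + z') y') ≡ ∣ z - z' ∣ + ∣ toℕ y - toℕ y' ∣
        place-dist O q {z} {z'} y y' q<k z< z'< = cong (_+ _) (begin
          ∣ toℕ (clamp (F O (q * W + z))) - toℕ (clamp (F O (q * W + z'))) ∣
            ≡⟨ cong₂ ∣_-_∣ (toℕ-place O (window<L q<k z<)) (toℕ-place O (window<L q<k z'<)) ⟩
          ∣ F O (q * W + z) - F O (q * W + z') ∣
            ≡⟨ F-isometry O (window<L q<k z<) (window<L q<k z'<) ⟩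
          ∣ q * W + z - q * W + z' ∣
            ≡⟨ ∣m+n-m+o∣≡∣n-o∣ (q * W) z z' ⟩
          ∣ z - z' ∣ ∎)
          where open ≡-Reasoning

        module _ (S S' : Setup) {q q' : ℕ} (q< : q < k) (q'< : q' < k)
                 (same₀ : σ S q ≡ σ S' q') (same₁ : σ S (suc q) ≡ σ S' (suc q')) where

          private
            O O' : Orientation
            O  = orient S
            O' = orient S'

          module _ (In : ℕ → Set) (In< : ∀ {z} → In z → z < 2 * W) where

            -- Identifiers match because both windows are copies of the same two stock blocks. The
            -- subset `In` of the window is a parameter because the two phases work with different
            -- regions.
            window-iso : PartialIso (id S) (id S') (Region O q In) (Region O' q' In)
            window-iso = record
              { to = move S q S' q'
              ; from = move S' q' S q
              ; to-D = λ { (z , y , iz , st , refl) → z , y , iz , st , move-place S q S' q' y q< (In< iz) }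
              ; from-D = λ { (z , y , iz , st , refl) → z , y , iz , st , move-place S' q' S q y q'< (In< iz) }
              ; from-to = λ { (z , y , iz , st , refl) →
                  trans (cong (move S' q' S q) (move-place S q S' q' y q< (In< iz))) (move-place S' q' S q y q'< (In< iz)) }
              ; to-from = λ { (z , y , iz , st , refl) →
                  trans (cong (move S q S' q') (move-place S' q' S q y q'< (In< iz))) (move-place S q S' q' y q< (In< iz)) }
              ; to-dist = λ { (z , y , iz , _ , refl) (z' , y' , iz' , _ , refl) →
                  trans (cong₂ dist (move-place S q S' q' y q< (In< iz)) (move-place S q S' q' y' q< (In< iz')))
                    (trans (place-dist O' q' y y' q'< (In< iz) (In< iz')) (sym (place-dist O q y y' q< (In< iz) (In< iz')))) }
              ; to-id = λ { (z , y , iz , st , refl) →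
                  trans (cong (id S') (move-place S q S' q' y q< (In< iz)))
                    (trans (id-lay S' (window<L q'< (In< iz)) st)
                      (trans (cong base (sym (lay-window {σ S} {σ S'} {q} {q'} same₀ same₁ (In< iz) y)))
                        (sym (id-lay S (window<L q< (In< iz)) st)))) } }

            open Simulation window-iso T

            -- `f` generalises the identity for the recursion through `applyUpTo`. By the last
            -- hypothesis a visit outside `In` is skipped in both runs, while any other has its
            -- whole ball in `In` and is matched.
            window-sim : ∀ {P : ℕ → Set} (P? : Decidable P) n (f : ℕ → ℕ) →
              (∀ t → t < n → f t < 2 * W) →
              (∀ z → z < 2 * W → (P (q * W + z) → P z) × (P z → P (q * W + z)) × (P (q' * W + z) → P z) × (P z → P (q' * W + z))) →
              (∀ z → z < 2 * W → P z → ¬ In z ⊎ (T ≤ z × z + T < 2 * W × (∀ z' → z ≤ z' + T → z' ≤ z + T → In z'))) →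
              Sim (visits O P? (applyUpTo (λ t → q * W + f t) n)) (visits O' P? (applyUpTo (λ t → q' * W + f t) n))
            window-sim P? zero f f< periodic cases = []
            window-sim {P} P? (suc n) f f< periodic cases
              with periodic (f 0) (f< 0 (s≤s z≤n)) | P? (q * W + f 0)
            ... | to-z , from-z , to-z' , from-z' | no ¬p
              rewrite filter-reject P? {x = q' * W + f 0} {xs = applyUpTo (λ t → q' * W + f (suc t)) n} (λ p → ¬p (from-z (to-z' p)))
              = window-sim P? n (λ t → f (suc t)) (λ t t< → f< (suc t) (s≤s t<)) periodic cases
            ... | to-z , from-z , to-z' , from-z' | yes p
              rewrite filter-accept P? {x = q' * W + f 0} {xs = applyUpTo (λ t → q' * W + f (suc t)) n} (from-z' (to-z p))
              with cases (f 0) (f< 0 (s≤s z≤n)) (to-z p) | window-sim P? n (λ t → f (suc t)) (λ t t< → f< (suc t) (s≤s t<)) periodic cases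
            ... | inj₁ ¬in | rest = skipˡ (not-in O q<) (skipʳ (not-in O' q'<) rest)
              where
              not-in : ∀ O {q} → q < k → ¬ Region O q In (place O (q * W + f 0) row)
              not-in O {q} q< = not-in-region O q< In< (window<L q< (f< 0 (s≤s z≤n)))
                λ iz e → ¬in (subst In (sym (+-cancelˡ-≡ (q * W) _ _ e)) iz)
            ... | inj₂ (T≤ , ≤2W , near) | rest =
              (move-place S q S' q' row q< (f< 0 (s≤s z≤n)) , ball-in-region O q< T≤ ≤2W near , ball-in-region O' q'< T≤ ≤2W near) ∷ˢ rest

            -- Both schedules are cut into five pieces: off the strip, before the window, the
            -- window, after it, off the strip. Only the middle pieces have to be matched; the
            -- others miss the region and are skipped.
            schedule-sim : ∀ {P : ℕ → Set} (P? : Decidable P) {pre post pre' post'} →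
              All Off pre → All Off post → All Off pre' → All Off post' →
              (∀ q z → (P (q * W + z) → P z) × (P z → P (q * W + z))) →
              (∀ z → z < 2 * W → P z → ¬ In z ⊎ (T ≤ z × z + T < 2 * W × (∀ z' → z ≤ z' + T → z' ≤ z + T → In z'))) →
              Sim (pre ++ (visits O P? (upTo L) ++ post)) (pre' ++ (visits O' P? (upTo L) ++ post'))
            schedule-sim P? off-pre off-post off-pre' off-post' periodic cases
              with visits-split O P? {q} q< | visits-split O' P? {q'} q'<
            ... | r , eq , split | r' , eq' , split' =
              skips (All.map (off-region O q In) off-pre) (All.map (off-region O' q' In) off-pre')
              ++ˢ (subst₂ Sim (sym split) (sym split')
                     ((skips (visits-before O q< In< P?) (visits-before O' q'< In< P?)
                       ++ˢ window-sim P? (2 * W) (λ t → t) (λ t t< → t<)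
                             (λ z _ → proj₁ (periodic q z) , proj₂ (periodic q z) , proj₁ (periodic q' z) , proj₂ (periodic q' z))
                             cases)
                      ++ˢ skips (visits-after O q< In< P? eq) (visits-after O' q'< In< P? eq'))
                   ++ˢ skips (All.map (off-region O q In) off-post) (All.map (off-region O' q' In) off-post'))

          cores-sim : Simulation.Sim (window-iso In₁ (λ z< → z<)) T (cores S) (cores S')
          cores-sim = schedule-sim In₁ (λ z< → z<) core? (off-pre₁ S) (off-post₁ S) (off-pre₁ S') (off-post₁ S')
            (λ q z → subst (λ r → T ≤ r × r ≤ 3 * T) (offset-% q z) , subst (λ r → T ≤ r × r ≤ 3 * T) (sym (offset-% q z)))
            (λ z z< core → inj₂ (proj₁ (core-interior z< core) , proj₂ (core-interior z< core) ,
              λ z' _ z'≤ → ≤-<-trans z'≤ (proj₂ (core-interior z< core))))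

          rests-sim : Simulation.Sim (window-iso In₂ In₂⇒In₁) T (rests S) (rests S')
          rests-sim = schedule-sim In₂ In₂⇒In₁ (λ z → ¬? (core? z)) (off-pre₂ S) (off-post₂ S) (off-pre₂ S') (off-post₂ S')
            (λ q z → (λ ¬core core → ¬core (subst (λ r → T ≤ r × r ≤ 3 * T) (sym (offset-% q z)) core))
                   , (λ ¬core core → ¬core (subst (λ r → T ≤ r × r ≤ 3 * T) (offset-% q z) core)))
            cases
            where
            open ≤-Reasoning
            cases : ∀ z → z < 2 * W → ¬ Core z →
              ¬ In₂ z ⊎ (T ≤ z × z + T < 2 * W × (∀ z' → z ≤ z' + T → z' ≤ z + T → In₂ z'))
            cases z z< ¬core with T ≤? z | z ≤? W + 3 * T
            ... | no T≰z | _ = inj₁ λ in-z → T≰z (proj₁ in-z)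
            ... | yes _ | no z≰ = inj₁ λ in-z → z≰ (proj₂ in-z)
            -- Such a node lies strictly between the two cores, and `T` further steps to either side
            -- stay within `In₂`.
            ... | yes T≤z | yes z≤ with ¬core-interior z< ¬core T≤z z≤
            ...   | 3T<z , z<W+T = inj₂ (T≤z , In₂⇒In₁ (≤-trans T≤z (m≤m+n z T) , z+T≤) , λ z' z≤z'+T z'≤z+T →
                      +-cancelʳ-≤ T T z' (begin
                        T + T     ≤⟨ +-monoʳ-≤ T (m≤m+n T (T + 0)) ⟩
                        3 * T     ≤⟨ <⇒≤ 3T<z ⟩
                        z         ≤⟨ z≤z'+T ⟩
                        z' + T    ∎) , ≤-trans z'≤z+T z+T≤)
              where
              z+T≤ : z + T ≤ W + 3 * T
              z+T≤ = begin
                z + T       ≤⟨ +-monoˡ-≤ T (<⇒≤ z<W+T) ⟩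
                W + T + T   ≡⟨ +-assoc W T T ⟩
                W + (T + T) ≤⟨ +-monoʳ-≤ W (+-monoʳ-≤ T (m≤m+n T (T + 0))) ⟩
                W + 3 * T   ∎

        module _ {M : Set} (A : Algorithm M) where

          outcome : Setup → State M (suc m) (suc m)
          outcome S = run A (id S) (run A (id S) (λ _ → nothing) (cores S)) (rests S)

          -- After the first phase the runs agree on the whole window, since the balls of its cores
          -- stay in it. Both isomorphisms use the same map, so the agreement restricts to `In₂` and
          -- survives the second phase.
          outcome-window : ∀ {Tf} → Local Tf A → Tf (suc m * suc m) ≡ T → ∀ (S S' : Setup) {q q'} → q < k → q' < k →
            σ S q ≡ σ S' q' → σ S (suc q) ≡ σ S' (suc q') → ∀ {z} → T ≤ z → z ≤ W + 3 * T →
            outcome S' (place (orient S') (q' * W + z) row) ≡ outcome S (place (orient S) (q * W + z) row)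
          outcome-window {Tf} local T≡ S S' {q} {q'} q< q'< same₀ same₁ {z} T≤z z≤ =
            trans (cong (outcome S') (sym (move-place S q S' q' row q< (In₂⇒In₁ (T≤z , z≤)))))
              (agree₂ (z , row , (T≤z , z≤) , strip , refl))
            where
            c≡ : toℕ row ≡ c
            c≡ = toℕ-clamp (s≤s c≤)
            strip : InStrip row
            strip = ≤-trans (≤-reflexive (sym c≡)) (m≤m+n _ T) , ≤-trans (≤-reflexive c≡) (m≤m+n c T)
            iso₁ = window-iso S S' q< q'< same₀ same₁ In₁ (λ z< → z<)
            iso₂ = window-iso S S' q< q'< same₀ same₁ In₂ (In₂⇒In₁)
            agree₁ : Simulation.Agree iso₁ T (run A (id S) (λ _ → nothing) (cores S)) (run A (id S') (λ _ → nothing) (cores S'))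
            agree₁ = Simulation.run-sim iso₁ T {Tf = Tf} A local T≡ (cores-sim S S' q< q'< same₀ same₁) (λ _ → refl)
            agree₂ : Simulation.Agree iso₂ T (outcome S) (outcome S')
            agree₂ = Simulation.run-sim iso₂ T {Tf = Tf} A local T≡ (rests-sim S S' q< q'< same₀ same₁)
              λ { (z , y , in-z , st , e) → agree₁ (z , y , In₂⇒In₁ in-z , st , e) }

-- The adversary

-- The default `zero` for a missing output is harmless, as `ProperColoring` provides outputs at both
-- ends of every edge.
colour : ∀ {M : Set} → Maybe (Color × M) → Color
colour = maybe′ proj₁ zero

proper-colour : ∀ {M a b} {s : State M a b} → ProperColoring s → ∀ u w → Adj u w → colour (s u) ≢ colour (s w)
proper-colour proper u w adj eq with proper u w adj
... | p , q , su , sw , p≢q = p≢q (trans (cong colour (sym su)) (trans eq (cong colour sw)))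

∣n-1+n∣≡1 : ∀ n → ∣ n - suc n ∣ ≡ 1
∣n-1+n∣≡1 zero    = refl
∣n-1+n∣≡1 (suc n) = ∣n-1+n∣≡1 n

map-unique-on : ∀ {X Y : Set} {f : X → Y} {P : X → Set} → (∀ {x y} → P x → P y → f x ≡ f y → x ≡ y) →
  ∀ {xs} → All P xs → Unique xs → Unique (map f xs)
map-unique-on inj []         []           = []
map-unique-on inj (px ∷ pxs) (x∉xs ∷ uxs) =
  AllP.map⁺ (All.zipWith (λ { (py , x≢y) e → x≢y (inj px py e) }) (pxs , x∉xs)) ∷ map-unique-on inj pxs uxs

-- Valid orders and identifiers

module _ {a b : ℕ} where

  allNodes : List (Node a b)
  allNodes = cartesianProduct (allFin a) (allFin b)

  ∈-allNodes : ∀ v → v ∈ allNodes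
  ∈-allNodes (x , y) = ∈-cartesianProduct⁺ (∈-allFin x) (∈-allFin y)

  open import Data.List.Membership.DecPropositional (_≟N_ {a} {b}) using (_∈?_)

  remaining : List (Node a b) → List (Node a b)
  remaining vs = filter (λ v → ¬? (v ∈? vs)) allNodes

  remaining-∉ : ∀ vs {v} → v ∈ remaining vs → v ∉ vs
  remaining-∉ vs v∈ = proj₂ (∈-filter⁻ (λ v → ¬? (v ∈? vs)) {xs = allNodes} v∈)

  -- All other nodes are appended at the end, where they cannot change outputs already fixed.
  completed-order : ∀ vs → Unique vs → ValidOrder (vs ++ remaining vs)
  completed-order vs unique =
    UniqueP.++⁺ unique (UniqueP.filter⁺ _ (UniqueP.cartesianProduct⁺ (UniqueP.allFin⁺ a) (UniqueP.allFin⁺ b)))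
      (λ (v∈ , v∈') → remaining-∉ vs v∈' v∈) ,
    covered
    where
    covered : ∀ v → v ∈ vs ++ remaining vs
    covered v with v ∈? vs
    ... | yes v∈ = ∈-++⁺ˡ v∈
    ... | no v∉ = ∈-++⁺ʳ vs (∈-filter⁺ _ (∈-allNodes v) v∉)

  number : Node a b → ℕ
  number (x , y) = suc (toℕ (combine x y))

  number-injective : ∀ {u v} → number u ≡ number v → u ≡ v
  number-injective {x , y} {x' , y'} e with FinP.combine-injective x y x' y' (FinP.toℕ-injective (suc-injective e))
  ... | refl , refl = refl

  number-valid : ∀ c → 1 ≤ c → {π : Node a b → Node a b} → Injective _≡_ _≡_ π → ValidIds c (number ∘ π)
  number-valid (suc c) _ {π} π-inj = (λ e → π-inj (number-injective e)) , λ v → s≤s z≤n , bound (π v)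
    where
    bound : ∀ v → number v ≤ (a * b) ^ suc c
    -- A node exists, so `a * b` is positive and the further factors of the power cannot decrease
    -- it.
    bound (x , y) = ≤-trans (FinP.toℕ<n i) (m≤m*n (a * b) ((a * b) ^ c) {{m^n≢0 (a * b) c {{>-nonZero (≤-trans (s≤s z≤n) (FinP.toℕ<n i))}}}})
      where i = combine x y

-- `ε` is the common sign along the chosen blocks. Erdős-Szekeres gives values that are all positive
-- or merely all nonpositive; `signed` therefore asks for non-vanishing, which parity supplies in
-- `line-wind`.
record Line (w : ℕ → ℕ → ℤ) (k : ℕ) : Set where
  field
    ε      : ℤ
    ε-sign : ε ≡ 1ℤ ⊎ ε ≡ -1ℤ
    σᴸ     : ℕ → ℕ
    σ<     : ∀ q → σᴸ q < suc (k * k)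
    σ-inj  : ∀ {q q'} → q ≤ k → q' ≤ k → σᴸ q ≡ σᴸ q' → q ≡ q'
    signed : ∀ q → q < k → w (σᴸ q) (σᴸ (suc q)) ≢ 0ℤ → 1ℤ ℤ.≤ ε ℤ.* w (σᴸ q) (σᴸ (suc q))

line : ∀ w k → Line w k
line w k with erdős-szekeres (λ i j → 0ℤ ℤP.<? w i j) k
... | v , v< , inj₁ ch = record
  { ε = 1ℤ ; ε-sign = inj₁ refl ; σᴸ = vertex k ch
  ; σ< = λ q → ≤-<-trans (vertex≤ k ch q) v< ; σ-inj = vertex-injective k ch
  ; signed = λ q q< _ → subst (1ℤ ℤ.≤_) (sym (ℤP.*-identityˡ _)) (ℤP.i<j⇒suc[i]≤j (vertex-related k ch q q<)) }
... | v , v< , inj₂ ch = record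
  { ε = -1ℤ ; ε-sign = inj₂ refl ; σᴸ = vertex k ch
  ; σ< = λ q → ≤-<-trans (vertex≤ k ch q) v< ; σ-inj = vertex-injective k ch
  ; signed = λ q q< w≢0 → subst (1ℤ ℤ.≤_) (sym (ℤP.-1*i≡-i _))
      (ℤP.i<j⇒suc[i]≤j (ℤP.neg-mono-< (ℤP.≤∧≢⇒< (ℤP.≮⇒≥ (vertex-related k ch q q<)) w≢0))) }

-- By `d<k`, twice `k` exceeds the bound on how much rows at distance `suc (2 * T)` can differ. By
-- `room`, a stock of `suc (k * k)` blocks fits into a row.
module Adversary (T m k : ℕ) (d<k : suc (2 * T) < k) (room : suc (k * k) * suc (4 * T) ≤ suc m)
                 {M : Set} {Tf : ℕ → ℕ} (A : Algorithm M) (local : Local Tf A) (T≡ : Tf (suc m * suc m) ≡ T) where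
  open Geometry T m k
  open Orientation
  open Setup

  0<k : 0 < k
  0<k = ≤-trans (s≤s z≤n) d<k

  k≤k² : k ≤ k * k
  k≤k² = m≤m*n k k {{>-nonZero 0<k}}

  L≤ : L ≤ suc m
  L≤ = ≤-trans (*-monoˡ-≤ W (s≤s k≤k²)) room

  -- The radius-`T` strips around these rows are rows 0 to `2 * T` and the next `suc (2 * T)` rows,
  -- hence disjoint.
  c₁ c₂ : ℕ
  c₁ = T
  c₂ = T + suc (2 * T)

  c₂≤ : c₂ ≤ m
  c₂≤ = ≤-pred (begin
    suc c₂              ≤⟨ ≤-trans (m≤m+n (suc c₂) (5 * T)) (≤-reflexive (lem T)) ⟩
    2 * W               ≤⟨ *-monoˡ-≤ W (s≤s (≤-trans 0<k k≤k²)) ⟩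
    suc (k * k) * W     ≤⟨ room ⟩
    suc m               ∎)
    where
    open ≤-Reasoning
    lem : ∀ T → suc (T + suc (2 * T)) + 5 * T ≡ 2 * suc (4 * T)
    lem = ℕSolver.solve-∀

  c₁≤ : c₁ ≤ m
  c₁≤ = ≤-trans (m≤m+n T _) c₂≤

  pair : ℕ → ℕ → ℕ → ℕ
  pair i j zero    = i
  pair i j (suc _) = j

  -- The column lies in the grid by `room`, so `clamp` is exact, and division by `W` recovers
  -- `σ (z / W)` and the offset `z % W` from it.
  lay-injective : ∀ σ → (∀ q → σ q < suc (k * k)) → (∀ {q q'} → q ≤ k → q' ≤ k → σ q ≡ σ q' → q ≡ q') →
    ∀ {z z' y y'} → z < L → z' < L → lay σ z y ≡ lay σ z' y' → z ≡ z'
  lay-injective σ σ< σ-inj {z} {z'} z<L z'<L e = begin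
    z                     ≡⟨ m≡m%n+[m/n]*n z W ⟩
    z % W + z / W * W     ≡⟨ cong₂ (λ r q → r + q * W) rem quot ⟩
    z' % W + z' / W * W   ≡⟨ m≡m%n+[m/n]*n z' W ⟨
    z'                    ∎
    where
    open ≡-Reasoning
    column : ℕ → ℕ
    column z = σ (z / W) * W + z % W
    column< : ∀ z → column z < suc m
    column< z = <-≤-trans (<-≤-trans (+-monoʳ-< (σ (z / W) * W) (m%n<n z W))
      (≤-trans (≤-reflexive (+-comm (σ (z / W) * W) W)) (*-monoˡ-≤ W (σ< (z / W))))) room
    column≡ : column z ≡ column z'
    column≡ = trans (sym (toℕ-clamp (column< z))) (trans (cong toℕ (proj₁ (,-injective e))) (toℕ-clamp (column< z')))
    column-% : ∀ z → column z % W ≡ z % W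
    column-% z = trans (offset-% (σ (z / W)) (z % W)) (m%n%n≡m%n z W)
    column-/ : ∀ z → column z / W ≡ σ (z / W)
    column-/ z = trans (offset-/ (σ (z / W)) (z % W)) (trans (cong (λ w → σ (z / W) + w) (m<n⇒m/n≡0 (m%n<n z W))) (+-identityʳ _))
    rem : z % W ≡ z' % W
    rem = trans (sym (column-% z)) (trans (cong (_% W) column≡) (column-% z'))
    quot : z / W ≡ z' / W
    quot = σ-inj (≤-pred (m<n*o⇒m/o<n {z} {suc k} {W} z<L)) (≤-pred (m<n*o⇒m/o<n {z'} {suc k} {W} z'<L))
      (trans (sym (column-/ z)) (trans (cong (_/ W) column≡) (column-/ z')))

  wind-mirrored : ∀ C → wind (λ t → C (F mirrored (2 * T + t))) (k * W) ≡ ℤ.- wind (λ t → C (2 * T + t)) (k * W)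
  wind-mirrored C = trans (wind-cong (k * W) (λ t t≤ → cong C (mirrored-centre t t≤))) (wind-reverse (λ t → C (2 * T + t)) (k * W))

  -- `ε` is the sign that the chosen blocks provide along coordinates and `η` the sign wanted along
  -- columns; the row is mirrored exactly when they differ.
  turn : ∀ {ε η} → ε ≡ 1ℤ ⊎ ε ≡ -1ℤ → η ≡ 1ℤ ⊎ η ≡ -1ℤ → Σ Orientation λ O → ∀ (C : ℕ → Color) →
    + k ℤ.≤ ε ℤ.* wind (λ t → C (F O (2 * T + t))) (k * W) → + k ℤ.≤ η ℤ.* wind (λ t → C (2 * T + t)) (k * W)
  turn (inj₁ refl) (inj₁ refl) = straight , λ C h → h
  turn (inj₂ refl) (inj₂ refl) = straight , λ C h → h
  turn (inj₁ refl) (inj₂ refl) = mirrored , λ C h → subst (+ k ℤ.≤_)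
    (trans (cong (λ w → 1ℤ ℤ.* w) (wind-mirrored C)) (trans (ℤP.*-identityˡ _) (sym (ℤP.-1*i≡-i _)))) h
  turn (inj₂ refl) (inj₁ refl) = mirrored , λ C h → subst (+ k ℤ.≤_)
    (trans (cong (λ w → -1ℤ ℤ.* w) (wind-mirrored C))
      (trans (ℤP.-1*i≡-i _) (trans (ℤP.neg-involutive _) (sym (ℤP.*-identityˡ _))))) h

  module Strip (c : ℕ) (c≤ : c ≤ m) where

    -- The row starts with blocks `i` and `j`, and later positions repeat `j`. Repeated identifiers
    -- are admissible here, as `Local` speaks of arbitrary assignments and only the first window is
    -- compared.
    reference : ℕ → ℕ → Setup L≤ c c≤ number
    reference i j = record
      { orient = straight ; σ = pair i j
      ; id = λ (x , y) → number (lay (pair i j) (toℕ x) y)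
      ; id-lay = λ {z} {y} z< _ → cong (λ w → number (lay (pair i j) w y)) (toℕ-place L≤ straight z<)
      ; pre₁ = [] ; post₁ = [] ; pre₂ = [] ; post₂ = []
      ; off-pre₁ = [] ; off-post₁ = [] ; off-pre₂ = [] ; off-post₂ = [] }

    -- The quantity w(i,j), measured in a run with no other strip: offset `2 * T` is a block centre
    -- and the next centre is `W` further.
    blockWind : ℕ → ℕ → ℤ
    blockWind i j = wind (λ t → colour (outcome L≤ c c≤ number A (reference i j) (place straight (2 * T + t) (row L≤ c c≤)))) W

    module _ (ℓ : Line blockWind k) where
      open Line ℓ

      module _ (S : Setup L≤ c c≤ number) (σ≡ : σ S ≡ σᴸ) {s : State M (suc m) (suc m)} (proper : ProperColoring s)
               (s≡ : ∀ z → z < L → s (place (orient S) z (row L≤ c c≤))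
                                 ≡ outcome L≤ c c≤ number A S (place (orient S) z (row L≤ c c≤))) where

        private
          C : ℕ → Color
          C t = colour (s (place (orient S) (2 * T + t) (row L≤ c c≤)))

        centre< : ∀ t → t ≤ k * W → 2 * T + t < L
        centre< t t≤ = +-mono-≤ (s≤s (*-monoˡ-≤ T {2} {4} (s≤s (s≤s z≤n)))) t≤

        C-proper : ∀ t → t < k * W → C t ≢ C (suc t)
        C-proper t t< = proper-colour proper _ _ (cong₂ _+_ (begin
          ∣ toℕ (clamp (F O (2 * T + t))) - toℕ (clamp (F O (2 * T + suc t))) ∣
            ≡⟨ cong₂ ∣_-_∣ (toℕ-place L≤ O (centre< t (<⇒≤ t<))) (toℕ-place L≤ O (centre< (suc t) t<)) ⟩
          ∣ F O (2 * T + t) - F O (2 * T + suc t) ∣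
            ≡⟨ F-isometry O (centre< t (<⇒≤ t<)) (centre< (suc t) t<) ⟩
          ∣ 2 * T + t - 2 * T + suc t ∣
            ≡⟨ ∣m+n-m+o∣≡∣n-o∣ (2 * T) t (suc t) ⟩
          ∣ t - suc t ∣
            ≡⟨ ∣n-1+n∣≡1 t ⟩
          1 ∎) (∣n-n∣≡0 (toℕ (row L≤ c c≤))))
          where
          open ≡-Reasoning
          O : Orientation
          O = orient S

        block-end : ∀ {q t} → q < k → t ≤ W → q * W + t ≤ k * W
        block-end {q} {t} q< t≤ = ≤-trans (+-monoʳ-≤ (q * W) t≤) (≤-trans (≤-reflexive (+-comm (q * W) W)) (*-monoˡ-≤ W q<))

        C-block : ∀ q → q < k → wind (λ t → C (q * W + t)) W ≡ blockWind (σᴸ q) (σᴸ (suc q))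
        C-block q q< = wind-cong W λ t t≤ → cong colour (begin
          s (place (orient S) (2 * T + (q * W + t)) (row L≤ c c≤))
            ≡⟨ s≡ _ (centre< _ (block-end q< t≤)) ⟩
          outcome L≤ c c≤ number A S (place (orient S) (2 * T + (q * W + t)) (row L≤ c c≤))
            ≡⟨ cong (λ z → outcome L≤ c c≤ number A S (place (orient S) z (row L≤ c c≤))) (swap-summands (2 * T) (q * W) t) ⟩
          outcome L≤ c c≤ number A S (place (orient S) (q * W + (2 * T + t)) (row L≤ c c≤))
            -- Offsets `2 * T` to `2 * T + W` lie within `T` to `W + 3 * T`, where window `q` of the
            -- row agrees with window 0 of the reference run.
            ≡⟨ outcome-window L≤ c c≤ number A {Tf} local T≡ S (reference (σᴸ q) (σᴸ (suc q))) q< 0<k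
                 (cong (λ f → f q) σ≡) (cong (λ f → f (suc q)) σ≡)
                 (≤-trans (m≤m+n T (T + 0)) (m≤m+n (2 * T) t))
                 (≤-trans (+-mono-≤ (*-monoˡ-≤ T {2} {3} (s≤s (s≤s z≤n))) t≤) (≤-reflexive (+-comm (3 * T) W))) ⟨
          outcome L≤ c c≤ number A (reference (σᴸ q) (σᴸ (suc q))) (place straight (2 * T + t) (row L≤ c c≤)) ∎)
          where
          open ≡-Reasoning
          swap-summands : ∀ x y z → x + (y + z) ≡ y + (x + z)
          swap-summands = ℕSolver.solve-∀

        line-wind : + k ℤ.≤ ε ℤ.* wind C (k * W)
        line-wind = wind-blocks ε C W k λ q q< →
          subst (λ w → 1ℤ ℤ.≤ ε ℤ.* w) (sym (C-block q q<)) (signed q q< λ w≡0 →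
            -- `W` is `suc (2 * (2 * T))`, so the winding is odd and cannot vanish.
            wind-odd (λ t → C (q * W + t)) W (2 * T) (cong suc (*-assoc 2 2 T))
              (λ t t< → subst (λ w → C (q * W + t) ≢ C w) (sym (+-suc (q * W) t))
                (C-proper (q * W + t) (<-≤-trans (+-monoʳ-< (q * W) t<) (≤-trans (≤-reflexive (+-comm (q * W) W)) (*-monoˡ-≤ W q<)))))
              (trans (C-block q q<) w≡0))

  -- Two strips in one grid

  in-visits : ∀ c c≤ O {P : ℕ → Set} (P? : Decidable P) {v} → v ∈ visits L≤ c c≤ O P? (upTo L) →
    ∃[ z ] (z < L × P z × v ≡ place O z (row L≤ c c≤))
  in-visits c c≤ O P? v∈ with ∈-map⁻ _ v∈
  ... | z , z∈ , eq with ∈-filter⁻ P? {xs = upTo L} z∈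
  ...   | z∈' , pz = z , ∈-upTo⁻ z∈' , pz , eq

  visits-unique : ∀ c c≤ O {P : ℕ → Set} (P? : Decidable P) → Unique (visits L≤ c c≤ O P? (upTo L))
  visits-unique c c≤ O P? = map-unique-on (λ z< z'< e → proj₁ (place-injective L≤ O z< z'< e))
    (AllP.filter⁺ P? (AllP.all-upTo L)) (UniqueP.filter⁺ P? (UniqueP.upTo⁺ L))

  module TwoStrips (ℓ₁ : Line (Strip.blockWind c₁ c₁≤) k) (ℓ₂ : Line (Strip.blockWind c₂ c₂≤) k) where
    module ℓ₁ = Line ℓ₁
    module ℓ₂ = Line ℓ₂

    O₁ O₂ : Orientation
    O₁ = proj₁ (turn ℓ₁.ε-sign (inj₁ refl))
    O₂ = proj₁ (turn ℓ₂.ε-sign (inj₂ refl))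

    -- Rows up to `2 * T` follow the first line of blocks, later rows the second. Each node keeps
    -- its row `y`, so the strips use different identifiers even where they choose the same blocks.
    ψ : Grid → Grid
    ψ (x , y) with toℕ y ≤? 2 * T
    ... | yes _ = lay ℓ₁.σᴸ (F O₁ (toℕ x)) y
    ... | no _  = lay ℓ₂.σᴸ (F O₂ (toℕ x)) y

    Relabelled : Grid → Set
    Relabelled (x , _) = toℕ x < L

    ψ-injective : ∀ {u v} → Relabelled u → Relabelled v → ψ u ≡ ψ v → u ≡ v
    ψ-injective {x , y} {x' , y'} x< x'< e with toℕ y ≤? 2 * T | toℕ y' ≤? 2 * T
    ... | yes _ | yes _ = cong₂ _,_ (FinP.toℕ-injective (F-injective O₁ x< x'<
            (lay-injective ℓ₁.σᴸ ℓ₁.σ< ℓ₁.σ-inj (F-< O₁ x<) (F-< O₁ x'<) e))) (proj₂ (,-injective e))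
    ... | no _  | no _  = cong₂ _,_ (FinP.toℕ-injective (F-injective O₂ x< x'<
            (lay-injective ℓ₂.σᴸ ℓ₂.σ< ℓ₂.σ-inj (F-< O₂ x<) (F-< O₂ x'<) e))) (proj₂ (,-injective e))
    ... | yes p | no ¬p = ⊥-elim (¬p (subst (λ y → toℕ y ≤ 2 * T) (proj₂ (,-injective e)) p))
    ... | no ¬p | yes p = ⊥-elim (¬p (subst (λ y → toℕ y ≤ 2 * T) (sym (proj₂ (,-injective e))) p))

    extension : Σ (Grid → Grid) λ π → Injective _≡_ _≡_ π × (∀ {u} → u ∈ allNodes → Relabelled u → π u ≡ ψ u)
    extension = Extension.extend _≟N_ (λ (x , _) → toℕ x <? L) ψ ψ-injective allNodes

    π : Grid → Grid
    π = proj₁ extension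

    ids : Grid → ℕ
    ids u = number (π u)

    π-place : ∀ O {z y} → z < L → π (place O z y) ≡ ψ (place O z y)
    π-place O {z} {y} z< = proj₂ (proj₂ extension) (∈-allNodes (place O z y))
      (subst (_< L) (sym (toℕ-place L≤ O z<)) (F-< O z<))

    F-place : ∀ O {z} → z < L → F O (toℕ (clamp (F O z))) ≡ z
    F-place O z< = trans (cong (F O) (toℕ-place L≤ O z<)) (F-involutive O z<)

    ids₁ : ∀ {z y} → z < L → InStrip L≤ c₁ c₁≤ y → ids (place O₁ z y) ≡ number (lay ℓ₁.σᴸ z y)
    ids₁ {z} {y} z< (_ , y≤) = cong number (trans (π-place O₁ z<) ψ-top)
      where
      ψ-top : ψ (place O₁ z y) ≡ lay ℓ₁.σᴸ z y
      ψ-top with toℕ y ≤? 2 * T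
      ... | yes _ = cong (λ w → lay ℓ₁.σᴸ w y) (F-place O₁ z<)
      ... | no ¬p = ⊥-elim (¬p (subst (λ w → toℕ y ≤ T + w) (sym (+-identityʳ T)) y≤))

    ids₂ : ∀ {z y} → z < L → InStrip L≤ c₂ c₂≤ y → ids (place O₂ z y) ≡ number (lay ℓ₂.σᴸ z y)
    ids₂ {z} {y} z< (≤y , _) = cong number (trans (π-place O₂ z<) ψ-bottom)
      where
      ψ-bottom : ψ (place O₂ z y) ≡ lay ℓ₂.σᴸ z y
      ψ-bottom with toℕ y ≤? 2 * T
      ... | yes p = ⊥-elim (<⇒≱ (+-cancelˡ-≤ T (suc (2 * T)) (toℕ y) (≤-trans ≤y (≤-reflexive (+-comm (toℕ y) T)))) p)
      ... | no _  = cong (λ w → lay ℓ₂.σᴸ w y) (F-place O₂ z<)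

    rest? : Decidable (λ z → ¬ Core z)
    rest? z = ¬? (core? z)

    V₁ V₂ : ∀ {P : ℕ → Set} → Decidable P → List Grid
    V₁ P? = visits L≤ c₁ c₁≤ O₁ P? (upTo L)
    V₂ P? = visits L≤ c₂ c₂≤ O₂ P? (upTo L)

    T+T<c₂ : T + T < c₂
    T+T<c₂ = +-monoʳ-< T (s≤s (m≤m+n T _))

    off₁ : ∀ {P} (P? : Decidable P) → All (Off L≤ c₁ c₁≤) (V₂ P?)
    off₁ P? = AllP.map⁺ (All.universal (λ z (_ , ≤T+T) → <⇒≱ T+T<c₂ (subst (_≤ T + T) (toℕ-clamp (s≤s c₂≤)) ≤T+T)) _)

    off₂ : ∀ {P} (P? : Decidable P) → All (Off L≤ c₂ c₂≤) (V₁ P?)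
    off₂ P? = AllP.map⁺ (All.universal (λ z (c₂≤T+T , _) →
      <⇒≱ T+T<c₂ (subst (λ w → c₂ ≤ w + T) (toℕ-clamp (s≤s c₁≤)) c₂≤T+T)) _)

    -- `S₁` and `S₂` describe the same run, seen from either strip: in each phase row `c₁` is
    -- visited before row `c₂`, so the other row is a `post` part for `S₁` and a `pre` part for
    -- `S₂`.
    S₁ : Setup L≤ c₁ c₁≤ number
    S₁ = record
      { orient = O₁ ; σ = ℓ₁.σᴸ ; id = ids ; id-lay = ids₁
      ; pre₁ = [] ; post₁ = V₂ core? ; pre₂ = [] ; post₂ = V₂ rest?
      ; off-pre₁ = [] ; off-post₁ = off₁ core? ; off-pre₂ = [] ; off-post₂ = off₁ rest? }

    S₂ : Setup L≤ c₂ c₂≤ number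
    S₂ = record
      { orient = O₂ ; σ = ℓ₂.σᴸ ; id = ids ; id-lay = ids₂
      ; pre₁ = V₁ core? ; post₁ = [] ; pre₂ = V₁ rest? ; post₂ = []
      ; off-pre₁ = off₂ core? ; off-post₁ = [] ; off-pre₂ = off₂ rest? ; off-post₂ = [] }

    rows-differ : row L≤ c₁ c₁≤ ≢ row L≤ c₂ c₂≤
    rows-differ e = <⇒≱ T+T<c₂ (≤-trans (≤-reflexive (trans (sym (toℕ-clamp (s≤s c₂≤)))
      (trans (cong toℕ (sym e)) (toℕ-clamp (s≤s c₁≤))))) (m≤m+n T T))

    V₁-V₂-disjoint : ∀ {P Q} (P? : Decidable P) (Q? : Decidable Q) → Disjoint (V₁ P?) (V₂ Q?)
    V₁-V₂-disjoint P? Q? (v∈₁ , v∈₂) with in-visits c₁ c₁≤ O₁ P? v∈₁ | in-visits c₂ c₂≤ O₂ Q? v∈₂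
    ... | _ , _ , _ , e | _ , _ , _ , e' = rows-differ (proj₂ (,-injective (trans (sym e) e')))

    core-rest-disjoint : ∀ c c≤ O → Disjoint (visits L≤ c c≤ O core? (upTo L)) (visits L≤ c c≤ O rest? (upTo L))
    core-rest-disjoint c c≤ O (v∈ , v∈') with in-visits c c≤ O core? v∈ | in-visits c c≤ O rest? v∈'
    ... | z , z< , core , e | z' , z'< , ¬core , e' =
      ¬core (subst Core (proj₁ (place-injective L≤ O z< z'< (trans (sym e) e'))) core)

    schedule : List Grid
    schedule = cores S₁ ++ rests S₁

    schedule-unique : Unique schedule
    schedule-unique = UniqueP.++⁺ (phase core?) (phase rest?) disjoint
      where
      phase : ∀ {P} (P? : Decidable P) → Unique (V₁ P? ++ V₂ P?)
      phase P? = UniqueP.++⁺ (visits-unique c₁ c₁≤ O₁ P?) (visits-unique c₂ c₂≤ O₂ P?) (V₁-V₂-disjoint P? P?)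
      disjoint : Disjoint (cores S₁) (rests S₁)
      disjoint (v∈ , v∈') with ∈-++⁻ (V₁ core?) v∈ | ∈-++⁻ (V₁ rest?) v∈'
      ... | inj₁ p | inj₁ q = core-rest-disjoint c₁ c₁≤ O₁ (p , q)
      ... | inj₁ p | inj₂ q = V₁-V₂-disjoint core? rest? (p , q)
      ... | inj₂ p | inj₁ q = V₁-V₂-disjoint rest? core? (q , p)
      ... | inj₂ p | inj₂ q = core-rest-disjoint c₂ c₂≤ O₂ (p , q)

    scheduled₁ : ∀ {z} → z < L → place O₁ z (row L≤ c₁ c₁≤) ∈ schedule
    scheduled₁ {z} z< with core? z
    ... | yes p = ∈-++⁺ˡ (∈-++⁺ˡ (∈-map⁺ _ (∈-filter⁺ core? (∈-upTo⁺ z<) p)))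
    ... | no ¬p = ∈-++⁺ʳ (cores S₁) (∈-++⁺ˡ (∈-map⁺ _ (∈-filter⁺ rest? (∈-upTo⁺ z<) ¬p)))

    scheduled₂ : ∀ {z} → z < L → place O₂ z (row L≤ c₂ c₂≤) ∈ schedule
    scheduled₂ {z} z< with core? z
    ... | yes p = ∈-++⁺ˡ (∈-++⁺ʳ (V₁ core?) (∈-map⁺ _ (∈-filter⁺ core? (∈-upTo⁺ z<) p)))
    ... | no ¬p = ∈-++⁺ʳ (cores S₁) (∈-++⁺ʳ (V₁ rest?) (∈-map⁺ _ (∈-filter⁺ rest? (∈-upTo⁺ z<) ¬p)))

    coloured : State M (suc m) (suc m)
    coloured = final A ids (schedule ++ remaining schedule)

    outcomes-agree : outcome L≤ c₂ c₂≤ number A S₂ ≡ outcome L≤ c₁ c₁≤ number A S₁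
    outcomes-agree = cong₂ (λ vs ws → run A ids (run A ids (λ _ → nothing) vs) ws)
      (cong (V₁ core? ++_) (++-identityʳ (V₂ core?))) (cong (V₁ rest? ++_) (++-identityʳ (V₂ rest?)))

    coloured-scheduled : ∀ {v} → v ∈ schedule → coloured v ≡ outcome L≤ c₁ c₁≤ number A S₁ v
    coloured-scheduled {v} v∈ = begin
      run A ids (λ _ → nothing) (schedule ++ remaining schedule) v
        ≡⟨ cong (λ s → s v) (run-++ A ids (λ _ → nothing) schedule (remaining schedule)) ⟩
      run A ids (run A ids (λ _ → nothing) schedule) (remaining schedule) v
        ≡⟨ run-other A ids _ (remaining schedule) (λ v∈' → remaining-∉ schedule v∈' v∈) ⟩
      run A ids (λ _ → nothing) schedule v
        ≡⟨ cong (λ s → s v) (run-++ A ids (λ _ → nothing) (cores S₁) (rests S₁)) ⟩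
      outcome L≤ c₁ c₁≤ number A S₁ v ∎
      where open ≡-Reasoning

    module _ (proper : ProperColoring coloured) where

      -- The rectangle spanned by the two rows and the first and last block centres: `y = 0` is row
      -- `c₁` and `y = suc (2 * T)` is row `c₂`.
      G : ℕ → ℕ → Color
      G y t = colour (coloured (clamp (2 * T + t) , clamp (T + y)))

      column< : ∀ {t} → t ≤ k * W → 2 * T + t < suc m
      column< {t} t≤ = ≤-trans (+-mono-≤ (s≤s (*-monoˡ-≤ T {2} {4} (s≤s (s≤s z≤n)))) t≤) L≤

      row< : ∀ {y} → y ≤ suc (2 * T) → T + y < suc m
      row< y≤ = s≤s (≤-trans (+-monoʳ-≤ T y≤) c₂≤)

      step-dist : ∀ {o t} → o + suc t < suc m → ∣ toℕ (clamp (o + t)) - toℕ (clamp (o + suc t)) ∣ ≡ 1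
      step-dist {o} {t} lt = trans
        (cong₂ ∣_-_∣ (toℕ-clamp (<-trans (+-monoʳ-< o (n<1+n t)) lt)) (toℕ-clamp lt))
        (trans (∣m+n-m+o∣≡∣n-o∣ o t (suc t)) (∣n-1+n∣≡1 t))

      rows-close : wind (G 0) (k * W) ℤ.≤ wind (G (suc (2 * T))) (k * W) ℤ.+ + (2 * suc (2 * T))
      rows-close = wind-rows G (k * W) (suc (2 * T))
        (λ t y t< y≤ → proper-colour proper _ _ (cong₂ _+_ (step-dist (column< t<)) (∣n-n∣≡0 (toℕ (clamp (T + y))))))
        (λ t y t≤ y< → proper-colour proper _ _ (cong₂ _+_ (∣n-n∣≡0 (toℕ (clamp (2 * T + t)))) (step-dist (row< y<))))

      top : + k ℤ.≤ wind (G 0) (k * W)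
      top = subst (+ k ℤ.≤_) (trans (ℤP.*-identityˡ _)
              (wind-cong (k * W) λ t _ → cong (λ y → colour (coloured (clamp (2 * T + t) , clamp y))) (sym (+-identityʳ T))))
        (proj₂ (turn ℓ₁.ε-sign (inj₁ refl)) (λ x → colour (coloured (clamp x , row L≤ c₁ c₁≤)))
          (Strip.line-wind c₁ c₁≤ ℓ₁ S₁ refl proper (λ z z< → coloured-scheduled (scheduled₁ z<))))

      bottom : + k ℤ.≤ ℤ.- wind (G (suc (2 * T))) (k * W)
      bottom = subst (+ k ℤ.≤_) (ℤP.-1*i≡-i _)
        (proj₂ (turn ℓ₂.ε-sign (inj₂ refl)) (λ x → colour (coloured (clamp x , row L≤ c₂ c₂≤)))
          (Strip.line-wind c₂ c₂≤ ℓ₂ S₂ refl proper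
            (λ z z< → trans (coloured-scheduled (scheduled₂ z<)) (cong (λ s → s (place O₂ z (row L≤ c₂ c₂≤))) (sym outcomes-agree)))))

      improper : ⊥
      -- `top`, `rows-close` and `bottom` add up to `k + k ≤ 2 * suc (2 * T)`, against `d<k`.
      improper = <⇒≱ (+-mono-< d<k (subst (_< k) (sym (+-identityʳ (suc (2 * T)))) d<k)) (ℤP.drop‿+≤+ (begin
        + k ℤ.+ + k
          ≤⟨ ℤP.+-mono-≤ (ℤP.≤-trans top rows-close) bottom ⟩
        wind (G (suc (2 * T))) (k * W) ℤ.+ + (2 * suc (2 * T)) ℤ.+ ℤ.- wind (G (suc (2 * T))) (k * W)
          ≡⟨ lem (wind (G (suc (2 * T))) (k * W)) (+ (2 * suc (2 * T))) ⟩
        + (2 * suc (2 * T)) ∎))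
        where
        open ℤP.≤-Reasoning
        lem : ∀ x y → x ℤ.+ y ℤ.+ ℤ.- x ≡ y
        lem = ℤSolver.solve-∀

    unsolvable-by-lines : ∀ c → 1 ≤ c → ¬ Solves c A
    unsolvable-by-lines c 1≤c solves = improper (solves (suc m) (suc m) ids (schedule ++ remaining schedule)
      (number-valid c 1≤c (proj₁ (proj₂ extension))) (completed-order schedule schedule-unique))

  unsolvable : ∀ c → 1 ≤ c → ¬ Solves c A
  unsolvable = TwoStrips.unsolvable-by-lines (line (Strip.blockWind c₁ c₁≤) k) (line (Strip.blockWind c₂ c₂≤) k)

-- Size of the grid

enough-room : ∀ t m → 5 ≤ m → 7225 * t ^ 10 ≤ m * m → suc ((2 * t + 2) * (2 * t + 2)) * suc (4 * t) ≤ m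
-- For `t = 0` the required room is exactly 5.
enough-room zero    m 5≤m _     = 5≤m
-- For positive `t` the required room is a cubic in `t` whose coefficients sum to 85, hence at most
-- `85 * t ^ 3`. A smaller `m` would have its square below `7225 * t ^ 6`, where 7225 is the square
-- of 85.
enough-room (suc s) m _   bound = ≮⇒≥ λ m< → let small = <-≤-trans m< cubic in
  <⇒≱ (*-mono-< small small) (begin
    85 * suc s ^ 3 * (85 * suc s ^ 3) ≡⟨ square (suc s) ⟩
    7225 * suc s ^ 6                  ≤⟨ *-monoʳ-≤ 7225 (^-monoʳ-≤ (suc s) (m≤m+n 6 4)) ⟩
    7225 * suc s ^ 10                 ≤⟨ bound ⟩
    m * m                             ∎)
  where
  open ≤-Reasoning
  -- The powers are written out because the solver does not interpret _^_ .
  expand : ∀ s → suc ((2 * suc s + 2) * (2 * suc s + 2)) * suc (4 * suc s)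
    + (69 * s * s * s + 171 * s * s + 107 * s) ≡ 85 * (suc s * (suc s * (suc s * 1)))
  expand = ℕSolver.solve-∀
  square : ∀ u → 85 * (u * (u * (u * 1))) * (85 * (u * (u * (u * 1)))) ≡ 7225 * (u * (u * (u * (u * (u * (u * 1))))))
  square = ℕSolver.solve-∀
  cubic : suc ((2 * suc s + 2) * (2 * suc s + 2)) * suc (4 * suc s) ≤ 85 * suc s ^ 3
  cubic = m+n≤o⇒m≤o _ (≤-reflexive (expand s))

theorem4p1 : (c : ℕ) → 1 ≤ c → (T : ℕ → ℕ) → LittleO-n^1/10 T →
    (M : Set) → (A : Algorithm M) → Local T A → ¬ Solves c A
theorem4p1 c 1≤c T o M A local =
  -- `2 * T n + 2` is the least `k` above `suc (2 * T n)`.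
  Adversary.unsolvable (T n) m (2 * T n + 2) (≤-reflexive (+-comm 2 (2 * T n)))
    (enough-room (T n) (suc m) (m≤n⇒m≤1+n (m≤n+m 5 N)) (proj₂ (o 7225) n N≤n)) {Tf = T} A local refl c 1≤c
  where
  -- `N` comes from the little-o condition with the constant 7225 of `enough-room`; the added 5
  -- serves the case that `T n` is 0, and the square `n` is at least `N`.
  N m n : ℕ
  N = proj₁ (o 7225)
  m = N + 5
  n = suc m * suc m
  N≤n : N ≤ n
  N≤n = ≤-trans (m≤m+n N 5) (≤-trans (n≤1+n m) (m≤m*n (suc m) (suc m)))
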